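{- Let $v\in\mathbb N_0^N$, $\mathbb T\in\mathrm{Tab}_\lambda$ and $1\le j\le N$. Then there are elements $H_u$ ($u\in\mathbb N_0^N$, $u\trianglelefteq v$) of the Hecke algebra such that $$x^v\,\mathbb T\,\Xi_j=x^v\otimes(\mathbb TH_v)+\sum_{v'\lhd v}x^{v'}\otimes(\mathbb TH_{v'}).$$
   Context: $N\ge2$, $q,s$ indeterminates, $K=\mathbb C(q,s)$. Operators act on the right, composed left to right. $\mathcal H_N(s)$ is generated by $T_1,\dots,T_{N-1}$ with $(T_i+1)(T_i-s)=0$ and braid relations. $\lambda$ is a partition of $N$ (French convention, rows numbered bottom to top); $\mathrm{Tab}_\lambda$ = reverse standard tableaux (bijective fillings by $1,\dots,N$ strictly decreasing left to right in rows and bottom to top in columns); $\mathrm{CT}_{\mathbb T}[i]$ = column minus row of the cell of $i$; $\mathbb T^{(i,j)}$ exchanges $i,j$. $V_\lambda$ has basis $\mathrm{Tab}_\lambda$ with right action $\mathbb TT_i=s\mathbb T$ if $i,i+1$ share a row, $-\mathbb T$ if they share a column, and if $i$ is in a higher row than $i+1$, with $m=\mathrm{CT}_{\mathbb T}[i+1]-\mathrm{CT}_{\mathbb T}[i]>0$, $\mathbb TT_i=\frac{s-1}{1-s^m}\mathbb T+\frac{s(1-s^{m+1})(1-s^{m-1})}{(1-s^m)^2}\mathbb T^{(i,i+1)}$; the remaining case is determined by this formula for $\mathbb T^{(i,i+1)}$ and the quadratic relation. $\mathcal M_\lambda=K[x_1,\dots,x_N]\otimes V_\lambda$, $x^v=x_1^{v_1}\cdots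 x_N^{v_N}$. With $p^{s_i}$ = $p$ with $x_i,x_{i+1}$ exchanged: $(p\otimes u)\mathbf T_i=(1-s)\frac{x_{i+1}(p-p^{s_i})}{x_i-x_{i+1}}\otimes u+p^{s_i}\otimes uT_i$, $(p\otimes u)\mathbf w=p(qx_N,x_1,\dots,x_{N-1})\otimes uT_1\cdots T_{N-1}$, $\mathbf T_i^{ -1}=s^{ -1}(\mathbf T_i+1-s)$, $\Xi_j=s^{j-N}\mathbf T_{j-1}^{ -1}\cdots\mathbf T_1^{ -1}\mathbf w\mathbf T_{N-1}\cdots\mathbf T_j$. Orders: $v^+$ is the decreasing rearrangement of $v$; $v\preceq v'$ iff $\sum_{k\le i}v_k\le\sum_{k\le i}v'_k$ for all $i$; $v\trianglelefteq v'$ iff either $v^+\ne v'^+$ and $v^+\preceq v'^+$, or $v^+=v'^+$ and $v\preceq v'$; $v'\lhd v$ means $v'\trianglelefteq v$ and $v'\neq v$. -}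

module Defs where

open import Level using (Level; _⊔_) renaming (suc to lsuc)
open import Algebra.Bundles using (CommutativeRing)
open import Algebra.Apartness.Bundles using (HeytingField)
open import Algebra.Morphism.Structures using (module RingMorphisms)
import Algebra.Apartness.Properties.HeytingCommutativeRing as HeytingProperties
import Algebra.Properties.Ring as RingProperties
import Algebra.Properties.Semiring.Exp as Exp
import Algebra.Solver.Ring.NaturalCoefficients.Default as RingSolver
open import Data.Bool.Base using (if_then_else_; true; false)
open import Data.Fin.Base as Fin using (Fin; zero; suc; toℕ; fromℕ<; inject₁)
import Data.Fin.Properties as Fin
open import Data.Fin.Permutation using (transpose)
open import Function.Construct.Composition using (_↔-∘_)
open import Relation.Binary.Definitions using (tri<; tri≈; tri>)
import Data.Fin.Permutation.Components as PC
open import Data.Integer.Base as ℤ using (ℤ; +_; ∣_∣)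
import Data.Integer.Properties as ℤ
open import Data.List.Base as List
  using (List; []; _∷_; _++_; length; map; concatMap; cartesianProductWith; filter; foldl;
         allFin; applyUpTo; reverse; take; upTo)
open import Data.Nat.ListAction using (sum)
import Data.List.Properties as List
open import Data.List.Membership.Propositional using (_∈_)
open import Data.List.Membership.Propositional.Properties
  using (∈-cartesianProductWith⁺; ∈-filter⁺; ∈-filter⁻; ∈-upTo⁺)
open import Data.List.Relation.Binary.Permutation.Propositional using (_↭_)
open import Data.List.Relation.Binary.Permutation.Propositional.Properties using (↭-length)
open import Data.List.Relation.Unary.All using (All)
open import Data.List.Relation.Unary.Any using (here)
open import Data.List.Relation.Unary.Linked using (Linked)
open import Data.List.Relation.Unary.Unique.Propositional using (Unique)
import Data.List.Relation.Unary.Unique.Propositional.Properties as Unique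
import Data.List.Relation.Unary.AllPairs as AllPairs
import Data.List.Relation.Unary.All as All
open import Data.Nat.Base as ℕ using (ℕ; zero; suc; _≤_; _<_; _≥_; _∸_; z≤n; s≤s; s<s; z<s)
import Data.Nat.Properties as ℕ
open import Data.Nat.ListAction.Properties using (sum-↭)
open import Data.Product.Base using (Σ; ∃; ∃₂; _×_; _,_; proj₁; proj₂; map₁)
open import Data.Product.Properties using (≡-dec)
open import Data.Product.Relation.Binary.Pointwise.NonDependent using (×-decSetoid)
open import Data.Sum.Base using (_⊎_; inj₁; inj₂)
open import Data.Vec.Base as Vec using (Vec; []; _∷_; _∷ʳ_; lookup; replicate; toList; zipWith; _[_]≔_)
import Data.Vec.Properties as Vec
open import Function.Base using (_∘_)
open import Function.Bundles using (_↔_; _⇔_; mk⇔; module Inverse)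
open import Relation.Binary.Bundles using (DecSetoid; Setoid)
open import Relation.Binary.PropositionalEquality as ≡ using (_≡_; _≢_; refl; cong; cong₂; subst; subst₂)
import Relation.Binary.PropositionalEquality.Properties as ≡
import Relation.Binary.Properties.DecTotalOrder ℕ.≤-decTotalOrder as ≥
open import Relation.Nullary using (¬_; Dec; yes; no; does; contradiction)
open import Relation.Nullary.Decidable using (_×-dec_; _⊎-dec_; ¬?; dec-true; dec-false; map′)
open import Data.List.Sort ≥.≥-decTotalOrder using (sort; sort-↭)

------------------------------------------------------------------------
-- Free modules

-- An element of the free R-module on B is written as a finite list of
-- (coefficient , basis element); two lists denote the same element when all
-- their coefficients agree.  Repeated basis elements and zero coefficients are
-- allowed.  The tensor product of the free modules on B and D is the free
-- module on B × D.

module FreeModule {c ℓ} (R : CommutativeRing c ℓ) where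
  open CommutativeRing R using (Carrier; _≈_; _+_; _*_; -_; 0#; 1#)

  private variable
    a b d : Level
    A : Set a
    B : Set b
    D : Set d

  infixr 8 _•_
  infixr 7 _⊗_
  infixl 6 _⊕_ _⊖_

  Free : Set b → Set (c ⊔ b)
  Free B = List (Carrier × B)

  basis : B → Free B
  basis b = (1# , b) ∷ []

  _⊕_ : Free B → Free B → Free B
  _⊕_ = _++_

  _•_ : Carrier → Free B → Free B
  k • m = map (map₁ (k *_)) m

  _⊖_ : Free B → Free B → Free B
  m ⊖ m′ = m ⊕ (- 1#) • m′

  ∑ : List A → (A → Free B) → Free B
  ∑ xs f = concatMap f xs

  linear : (B → Free D) → Free B → Free D
  linear f m = ∑ m λ (k , b) → k • f b

  _⊗_ : Free B → Free D → Free (B × D)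
  _⊗_ = cartesianProductWith λ (k , b) (l , d) → k * l , b , d

  module Equality {b ℓb} (B : DecSetoid b ℓb) where
    open DecSetoid B using (_≟_) renaming (Carrier to |B|)

    infix 4 _≋_

    coeff : |B| → Free |B| → Carrier
    coeff b []             = 0#
    coeff b ((k , b′) ∷ m) = (if does (b ≟ b′) then k else 0#) + coeff b m

    _≋_ : Free |B| → Free |B| → Set (b ⊔ ℓ)
    m ≋ m′ = ∀ b → coeff b m ≈ coeff b m′

------------------------------------------------------------------------
-- The field of rational functions in q and s

module HeytingFieldRing {c ℓ ℓ#} (K : HeytingField c ℓ ℓ#) where
  open import Algebra.Apartness.Bundles using (HeytingCommutativeRing)
  ring : CommutativeRing c ℓ
  ring = HeytingCommutativeRing.commutativeRing (HeytingField.heytingCommutativeRing K)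

-- Polynomials in two variables over C; (i , j) stands for q ^ i * s ^ j.

module BivariatePolynomials {c ℓ ℓ#} (C : HeytingField c ℓ ℓ#) where
  open HeytingField C using (Carrier; _#_; 0#)
  open FreeModule (HeytingFieldRing.ring C) public using (Free)
  open FreeModule.Equality (HeytingFieldRing.ring C) (≡.decSetoid (≡-dec ℕ._≟_ ℕ._≟_)) public
    using (coeff)

  Polynomial : Set c
  Polynomial = Free (ℕ × ℕ)

  Nonzero : Polynomial → Set ℓ#
  Nonzero P = ∃ λ e → coeff e P # 0#

  -- The value at (q , s) of the image of a polynomial under ι.
  module _ {c′ ℓ′} (R : CommutativeRing c′ ℓ′) where
    private module R = CommutativeRing R
    open R using (_+_; _*_)
    open Exp R.semiring using (_^_)

    evaluate : (Carrier → R.Carrier) → R.Carrier → R.Carrier → Polynomial → R.Carrier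
    evaluate ι q s []                = R.0#
    evaluate ι q s ((k , i , j) ∷ P) = ι k * (q ^ i * s ^ j) + evaluate ι q s P

-- The field C(q,s), characterised up to isomorphism over C: a field extension
-- of C generated, as a field, by two elements q, s algebraically independent
-- over C.  Heyting fields are fields in which "nonzero" is read as apartness
-- from zero, i.e. invertibility; classically these are exactly the fields, and
-- the complex numbers are one also constructively.

record RationalFunctionField {a ℓa ℓa#} (C : HeytingField a ℓa ℓa#) (c ℓ ℓ# : Level)
    : Set (a ⊔ ℓa ⊔ ℓa# ⊔ lsuc (c ⊔ ℓ ⊔ ℓ#)) where
  field
    heytingField : HeytingField c ℓ ℓ#

  open HeytingField heytingField public
  open BivariatePolynomials C using (Polynomial; Nonzero; evaluate)

  commutativeRing : CommutativeRing c ℓ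
  commutativeRing = HeytingFieldRing.ring heytingField

  open CommutativeRing commutativeRing public using (ring; rawRing; semiring; commutativeSemiring)
  open Exp semiring public using (_^_)
  open RingMorphisms (CommutativeRing.rawRing (HeytingFieldRing.ring C)) rawRing
    using (IsRingHomomorphism)

  field
    ι                    : HeytingField.Carrier C → Carrier
    ι-isRingHomomorphism : IsRingHomomorphism ι
    q s                  : Carrier

  eval : Polynomial → Carrier
  eval = evaluate commutativeRing ι q s

  field
    independent : ∀ P → Nonzero P → eval P # 0#
    generated   : ∀ x → ∃₂ λ P Q → Nonzero Q × x * eval Q ≈ eval P

------------------------------------------------------------------------
-- Inverses of s and of 1 - s ^ m, and the coefficients of the action on V_λ

module Coefficients {a ℓa ℓa# c ℓ ℓ#} {C : HeytingField a ℓa ℓa#}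
    (K : RationalFunctionField C c ℓ ℓ#) where
  open RationalFunctionField K renaming (refl to ≈-refl)
  open RingMorphisms.IsRingHomomorphism ι-isRingHomomorphism
  open HeytingProperties heytingCommutativeRing using (#-congʳ; 1#0; x-0≈x)
  private
    module C  = HeytingField C
    module C₀ = HeytingProperties C.heytingCommutativeRing
  open RingProperties ring using (-1*x≈-x)
  open import Relation.Binary.Reasoning.Setoid setoid

  recip : ∀ {x} → x # 0# → Carrier
  recip x#0 = proj₁ (#⇒invertible x#0)

  *-recip : ∀ {x} (x#0 : x # 0#) → x * recip x#0 ≈ 1#
  *-recip {x} x#0 = trans (*-congʳ (sym (x-0≈x x))) (proj₂ (proj₂ (#⇒invertible x#0)))

  s#0 : s # 0#
  s#0 = #-congʳ eq (independent ((C.1# , 0 , 1) ∷ []) ((0 , 1) , C₀.#-congʳ (C.sym (C.+-identityʳ C.1#)) C₀.1#0))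
    where
    eq : ι C.1# * (1# * (s * 1#)) + 0# ≈ s
    eq = begin
      ι C.1# * (1# * s ^ 1) + 0# ≈⟨ +-identityʳ _ ⟩
      ι C.1# * (1# * s ^ 1)      ≈⟨ *-cong 1#-homo (*-identityˡ _) ⟩
      1# * s ^ 1                 ≈⟨ *-identityˡ _ ⟩
      s ^ 1                      ≈⟨ *-identityʳ _ ⟩
      s                          ∎

  1-s^m#0 : ∀ {m} → 0 < m → 1# - s ^ m # 0#
  1-s^m#0 {suc m} _ = #-congʳ eq
    (independent ((C.1# , 0 , 0) ∷ (C.- C.1# , 0 , suc m) ∷ [])
      ((0 , 0) , C₀.#-congʳ (C.sym (C.trans (C.+-congˡ (C.+-identityʳ C.0#)) (C.+-identityʳ C.1#))) C₀.1#0))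
    where
    eq : ι C.1# * (1# * 1#) + (ι (C.- C.1#) * (1# * s ^ suc m) + 0#) ≈ 1# - s ^ suc m
    eq = begin
      ι C.1# * (1# * 1#) + (ι (C.- C.1#) * (1# * s ^ suc m) + 0#)
        ≈⟨ +-cong (*-cong 1#-homo (*-identityˡ _)) (+-identityʳ _) ⟩
      1# * 1# + ι (C.- C.1#) * (1# * s ^ suc m)
        ≈⟨ +-cong (*-identityˡ _) (*-cong (trans (-‿homo _) (-‿cong 1#-homo)) (*-identityˡ _)) ⟩
      1# + - 1# * s ^ suc m
        ≈⟨ +-congˡ (-1*x≈-x _) ⟩
      1# - s ^ suc m ∎

  s⁻¹ : Carrier
  s⁻¹ = recip s#0

  [1-s^_]⁻¹ : ∀ m {m>0 : 0 < m} → Carrier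
  [1-s^ m ]⁻¹ {m>0} = recip (1-s^m#0 m>0)

  diag : ∀ m → 0 < m → Carrier
  diag m m>0 = (s - 1#) * [1-s^ m ]⁻¹ {m>0}

  offDiag : ∀ m → 0 < m → Carrier
  offDiag m m>0 = s * (1# - s ^ suc m) * (1# - s ^ (m ∸ 1)) * ([1-s^ m ]⁻¹ {m>0} * [1-s^ m ]⁻¹ {m>0})

  -- This identity fixes the "remaining case" of the action of T_i.  If
  -- U T_i = A U + B 𝕋 with A = diag m, B = offDiag m, then the quadratic relation
  -- (U T_i) T_i = (s - 1) U T_i + s U reads
  --   B (𝕋 T_i) = B (s - 1 - A) 𝕋 + ((s - 1) A + s - A²) U,
  -- and (s - 1) A + s - A² = B, so that 𝕋 T_i = (s - 1 - A) 𝕋 + U (in the situation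
  -- at hand m ≥ 2, hence B is invertible).
  remaining-case : ∀ m (m>0 : 0 < m) →
    diag m m>0 * diag m m>0 + offDiag m m>0 ≈ (s - 1#) * diag m m>0 + s
  remaining-case (suc m) m>0 = begin
    (σ * I) * (σ * I) + s * F * E * (I * I)        ≈⟨ +-congˡ (*-congʳ (*-congˡ E≈)) ⟩
    (σ * I) * (σ * I) + s * F * (D + σ * p) * (I * I)
                                                   ≈⟨ solve 5 (λ σ I s F e →
                                                        (σ :* I) :* (σ :* I) :+ s :* F :* e :* (I :* I)
                                                        := (σ :* σ :* con 1 :+ s :* F :* e) :* (I :* I))
                                                        ≈-refl σ I s F (D + σ * p) ⟩
    (σ * σ * 1# + s * F * (D + σ * p)) * (I * I)   ≈⟨ *-congʳ (+-cong (*-congˡ 1≈) ≈-refl) ⟩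
    (σ * σ * (D + s * p) + s * F * (D + σ * p)) * (I * I)
                                                   ≈⟨ *-congʳ core ⟩
    (σ * σ * D + s * (D * D)) * (I * I)            ≈⟨ solve 4 (λ σ I s D →
                                                        (σ :* σ :* D :+ s :* (D :* D)) :* (I :* I)
                                                        := σ :* (σ :* I) :* (D :* I) :+ s :* ((D :* I) :* (D :* I)))
                                                        ≈-refl σ I s D ⟩
    σ * (σ * I) * (D * I) + s * ((D * I) * (D * I)) ≈⟨ +-cong (trans (*-congˡ DI) (*-identityʳ _))
                                                        (trans (*-congˡ (trans (*-cong DI DI) (*-identityˡ _))) (*-identityʳ _)) ⟩
    σ * (σ * I) + s                                ∎
    where
    open RingSolver commutativeSemiring
    σ = s - 1#
    p = s ^ m
    I = [1-s^ suc m ]⁻¹ {m>0}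
    D = 1# - s ^ suc m
    E = 1# - p
    F = 1# - s ^ suc (suc m)
    DI : D * I ≈ 1#
    DI = *-recip (1-s^m#0 m>0)
    x-y+y : ∀ x y → x - y + y ≈ x
    x-y+y x y = trans (+-assoc _ _ _) (trans (+-congˡ (-‿inverseˡ y)) (+-identityʳ x))
    1≈ : 1# ≈ D + s * p
    1≈ = sym (x-y+y 1# (s * p))
    s≈ : s ≈ σ + 1#
    s≈ = sym (x-y+y s 1#)
    cancel : ∀ {x y z} → x + z ≈ y + z → x ≈ y
    cancel = RingProperties.+-cancelʳ ring _ _ _
    E≈ : E ≈ D + σ * p
    E≈ = cancel {z = p} (begin
      E + p              ≈⟨ x-y+y 1# p ⟩
      1#                 ≈⟨ 1≈ ⟩
      D + s * p          ≈⟨ +-congˡ (*-congʳ s≈) ⟩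
      D + (σ + 1#) * p   ≈⟨ +-congˡ (trans (distribʳ _ _ _) (+-congˡ (*-identityˡ p))) ⟩
      D + (σ * p + p)    ≈⟨ +-assoc _ _ _ ⟨
      D + σ * p + p      ∎)
    D≈ : D ≈ F + s * (σ * p)
    D≈ = cancel {z = s * p} (begin
      D + s * p                    ≈⟨ 1≈ ⟨
      1#                           ≈⟨ x-y+y 1# _ ⟨
      F + s * (s * p)              ≈⟨ +-congˡ (*-congˡ (*-congʳ s≈)) ⟩
      F + s * ((σ + 1#) * p)       ≈⟨ +-congˡ (*-congˡ (trans (distribʳ _ _ _) (+-congˡ (*-identityˡ p)))) ⟩
      F + s * (σ * p + p)          ≈⟨ +-congˡ (distribˡ _ _ _) ⟩
      F + (s * (σ * p) + s * p)    ≈⟨ +-assoc _ _ _ ⟨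
      F + s * (σ * p) + s * p      ∎)
    core : σ * σ * (D + s * p) + s * F * (D + σ * p) ≈ σ * σ * D + s * (D * D)
    core = begin
      σ * σ * (D + s * p) + s * F * (D + σ * p)
        ≈⟨ solve 5 (λ σ D s p F → σ :* σ :* (D :+ s :* p) :+ s :* F :* (D :+ σ :* p)
             := σ :* σ :* D :+ s :* (σ :* σ :* p :+ F :* (D :+ σ :* p))) ≈-refl σ D s p F ⟩
      σ * σ * D + s * (σ * σ * p + F * (D + σ * p))
        ≈⟨ +-congˡ (*-congˡ (+-congʳ (trans (sym (*-identityʳ _)) (*-congˡ 1≈)))) ⟩
      σ * σ * D + s * (σ * σ * p * (D + s * p) + F * (D + σ * p))
        ≈⟨ +-congˡ (*-congˡ square) ⟩
      σ * σ * D + s * (D * D) ∎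
      where
      square : σ * σ * p * (D + s * p) + F * (D + σ * p) ≈ D * D
      square = begin
        σ * σ * p * (D + s * p) + F * (D + σ * p)
          ≈⟨ solve 5 (λ σ D s p F → σ :* σ :* p :* (D :+ s :* p) :+ F :* (D :+ σ :* p)
               := σ :* σ :* p :* D :+ F :* D :+ σ :* p :* (F :+ s :* (σ :* p))) ≈-refl σ D s p F ⟩
        σ * σ * p * D + F * D + σ * p * (F + s * (σ * p))
          ≈⟨ +-congˡ (*-congˡ D≈) ⟨
        σ * σ * p * D + F * D + σ * p * D
          ≈⟨ solve 4 (λ σ D p F → σ :* σ :* p :* D :+ F :* D :+ σ :* p :* D
               := (F :+ (σ :+ con 1) :* (σ :* p)) :* D) ≈-refl σ D p F ⟩
        (F + (σ + 1#) * (σ * p)) * D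
          ≈⟨ *-congʳ (+-congˡ (*-congʳ (sym s≈))) ⟩
        (F + s * (σ * p)) * D
          ≈⟨ *-congʳ D≈ ⟨
        D * D ∎

------------------------------------------------------------------------
-- Partitions and reverse standard tableaux

record Partition (N : ℕ) : Set where
  field
    parts      : List ℕ
    decreasing : Linked _≥_ parts
    positive   : All (0 <_) parts
    sum≡N      : sum parts ≡ N

-- The cells of the Young diagram.  Row r (counted from the bottom, starting at 0)
-- has lookup parts r cells.
record Cell {N : ℕ} (μ : Partition N) : Set where
  constructor cell
  open Partition μ using (parts)
  field
    r : Fin (length parts)
    c : Fin (List.lookup parts r)

  row col : ℕ
  row = toℕ r
  col = toℕ c

open Cell using (row; col)

_≟ᶜ_ : ∀ {N} {μ : Partition N} (x y : Cell μ) → Dec (x ≡ y)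
cell r c ≟ᶜ cell r′ c′ = map′ (λ { refl → refl }) (λ { refl → refl })
  (≡-dec Fin._≟_ Fin._≟_ (r , c) (r′ , c′))

-- The entries 1, …, N are represented by the elements 0, …, N - 1 of Fin N.
record Tab {N : ℕ} (μ : Partition N) : Set where
  field
    filling : Cell μ ↔ Fin N

  open Inverse filling public using () renaming (to to entry; from to cellOf)

  field
    row-decreasing : ∀ x y → row x ≡ row y → col x < col y → entry y Fin.< entry x
    col-decreasing : ∀ x y → col x ≡ col y → row x < row y → entry y Fin.< entry x

  CT : Fin N → ℤ
  CT i = + col (cellOf i) ℤ.- + row (cellOf i)

open Tab using (entry; cellOf; CT)

Tab-decSetoid : ∀ {N} → Partition N → DecSetoid _ _
Tab-decSetoid μ = record
  { Carrier = Tab μ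
  ; _≈_ = λ 𝕊 𝕋 → ∀ i → cellOf 𝕊 i ≡ cellOf 𝕋 i
  ; isDecEquivalence = record
    { isEquivalence = record
      { refl  = λ _ → refl
      ; sym   = λ p i → ≡.sym (p i)
      ; trans = λ p q i → ≡.trans (p i) (q i) }
    ; _≟_ = λ 𝕊 𝕋 → Fin.all? λ i → cellOf 𝕊 i ≟ᶜ cellOf 𝕋 i } }

-- T_i exchanges the entries at inject₁ i and suc i, for i : Fin n and N = suc n.

module _ {n : ℕ} (i : Fin n) where
  private
    σ : Fin (suc n) → Fin (suc n)
    σ = PC.transpose (inject₁ i) (suc i)
    toℕ-I : toℕ (inject₁ i) ≡ toℕ i
    toℕ-I = Fin.toℕ-inject₁ i

  transpose-mono : ∀ {a b} → a Fin.< b → ¬ (a ≡ inject₁ i × b ≡ suc i) → σ a Fin.< σ b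
  transpose-mono {a} {b} a<b ¬ab with a Fin.≟ inject₁ i | b Fin.≟ inject₁ i
  ... | yes refl | yes refl = contradiction a<b (ℕ.<-irrefl refl)
  ... | yes refl | no _ with b Fin.≟ suc i
  ...   | yes refl = contradiction (refl , refl) ¬ab
  ...   | no b≢J = ℕ.≤∧≢⇒< (subst (_< toℕ b) toℕ-I a<b) (λ e → b≢J (≡.sym (Fin.toℕ-injective e)))
  transpose-mono {a} {b} a<b ¬ab | no _ | yes refl with a Fin.≟ suc i
  ...   | yes refl = contradiction (subst (suc (toℕ i) <_) toℕ-I a<b) (ℕ.<-asym (ℕ.n<1+n _))
  ...   | no _ = ℕ.<-trans (subst (toℕ a <_) toℕ-I a<b) (ℕ.n<1+n _)
  transpose-mono {a} {b} a<b ¬ab | no a≢I | no _ with a Fin.≟ suc i | b Fin.≟ suc i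
  ...   | yes refl | yes refl = contradiction a<b (ℕ.<-irrefl refl)
  ...   | yes refl | no _ = subst (_< toℕ b) (≡.sym toℕ-I) (ℕ.<-trans (ℕ.n<1+n _) a<b)
  ...   | no _ | yes refl = ℕ.≤∧≢⇒< (subst (toℕ a ≤_) (≡.sym toℕ-I) (ℕ.s≤s⁻¹ a<b))
                                      (λ e → a≢I (Fin.toℕ-injective e))
  ...   | no _ | no _ = a<b

  transpose-J : PC.transpose (suc i) (inject₁ i) (suc i) ≡ inject₁ i
  transpose-J rewrite dec-true (suc i Fin.≟ suc i) refl = refl

  transpose-I : PC.transpose (suc i) (inject₁ i) (inject₁ i) ≡ suc i
  transpose-I
    rewrite dec-false (inject₁ i Fin.≟ suc i)
                      (λ e → ℕ.1+n≢n (≡.sym (≡.trans (≡.sym toℕ-I) (cong toℕ e))))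
          | dec-true (inject₁ i Fin.≟ inject₁ i) refl = refl

module _ {n : ℕ} {μ : Partition (suc n)} (𝕋 : Tab μ) (i : Fin n) where
  private
    x y : Cell μ
    x = cellOf 𝕋 (inject₁ i)
    y = cellOf 𝕋 (suc i)
    cell-entry : ∀ {z k} → entry 𝕋 z ≡ k → z ≡ cellOf 𝕋 k
    cell-entry {z} refl = ≡.sym (Inverse.strictlyInverseʳ (Tab.filling 𝕋) z)
    entry-cell : ∀ k → entry 𝕋 (cellOf 𝕋 k) ≡ k
    entry-cell = Inverse.strictlyInverseˡ (Tab.filling 𝕋)

  exchange : row x ≢ row y → col x ≢ col y → Tab μ
  exchange r≢ c≢ = record
    { filling = transpose (inject₁ i) (suc i) ↔-∘ Tab.filling 𝕋
    ; row-decreasing = λ u v r≡ c< → transpose-mono i (Tab.row-decreasing 𝕋 u v r≡ c<)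
        λ (p , q) → r≢ (≡.trans (cong row (≡.sym (cell-entry {v} p)))
                      (≡.trans (≡.sym r≡) (cong row (cell-entry {u} q))))
    ; col-decreasing = λ u v c≡ r< → transpose-mono i (Tab.col-decreasing 𝕋 u v c≡ r<)
        λ (p , q) → c≢ (≡.trans (cong col (≡.sym (cell-entry {v} p)))
                      (≡.trans (≡.sym c≡) (cong col (cell-entry {u} q)))) }

  -- If i is in a higher row than i + 1 and in a different column, then it is in a
  -- smaller column: otherwise the cell in the row of i and the column of i + 1
  -- would hold an entry strictly between i and i + 1.
  higher⇒col< : row y < row x → col x ≢ col y → col x < col y
  higher⇒col< r> c≢ with ℕ.<-cmp (col x) (col y)
  ... | tri< c< _ _ = c<
  ... | tri≈ _ c≡ _ = contradiction c≡ c≢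
  ... | tri> _ _ c> = contradiction (ℕ.≤-trans i<z (ℕ.s≤s⁻¹ z<1+i)) (ℕ.<-irrefl refl)
    where
    c<λr : col y < List.lookup (Partition.parts μ) (Cell.r x)
    c<λr = ℕ.<-trans c> (Fin.toℕ<n (Cell.c x))
    z : Cell μ
    z = cell (Cell.r x) (fromℕ< c<λr)
    col-z : col z ≡ col y
    col-z = Fin.toℕ-fromℕ< c<λr
    i<z : toℕ i < toℕ (entry 𝕋 z)
    i<z = subst (_< toℕ (entry 𝕋 z)) (≡.trans (cong toℕ (entry-cell (inject₁ i))) (Fin.toℕ-inject₁ i))
            (Tab.row-decreasing 𝕋 z x refl (subst (_< col x) (≡.sym col-z) c>))
    z<1+i : toℕ (entry 𝕋 z) < suc (toℕ i)
    z<1+i = subst (toℕ (entry 𝕋 z) <_) (cong toℕ (entry-cell (suc i)))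
              (Tab.col-decreasing 𝕋 y z (≡.sym col-z) r>)

  contentDifference : ℤ
  contentDifference = CT 𝕋 (suc i) ℤ.- CT 𝕋 (inject₁ i)

  higher⇒m>0 : row y < row x → col x ≢ col y → 0 < ∣ contentDifference ∣
  higher⇒m>0 r> c≢ = positive (ℤ.≤∧≢⇒< (ℤ.i≤j⇒0≤j-i (ℤ.<⇒≤ CT<)) λ e → ℤ.<-irrefl (≡.sym (ℤ.i-j≡0⇒i≡j _ _ (≡.sym e))) CT<)
    where
    CT< : CT 𝕋 (inject₁ i) ℤ.< CT 𝕋 (suc i)
    CT< = ℤ.+-mono-< (ℤ.+<+ (higher⇒col< r> c≢)) (ℤ.neg-mono-< (ℤ.+<+ r>))
    positive : ∀ {k} → + 0 ℤ.< k → 0 < ∣ k ∣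
    positive (ℤ.+<+ 0<k) = 0<k

exchange-m>0 : ∀ {n} {μ : Partition (suc n)} (𝕋 : Tab μ) (i : Fin n) →
  let x = cellOf 𝕋 (inject₁ i); y = cellOf 𝕋 (suc i) in
  (r≢ : row x ≢ row y) (c≢ : col x ≢ col y) → row x < row y →
  0 < ∣ contentDifference (exchange 𝕋 i r≢ c≢) i ∣
exchange-m>0 𝕋 i r≢ c≢ r< = higher⇒m>0 (exchange 𝕋 i r≢ c≢) i
  (subst₂ _<_ (cong (row ∘ cellOf 𝕋) (≡.sym (transpose-J i)))
              (cong (row ∘ cellOf 𝕋) (≡.sym (transpose-I i))) r<)
  (λ e → c≢ (≡.trans (cong (col ∘ cellOf 𝕋) (≡.sym (transpose-J i)))
               (≡.trans (≡.sym e) (cong (col ∘ cellOf 𝕋) (transpose-I i)))))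

------------------------------------------------------------------------
-- Exponent vectors and their orders

module Orders (n : ℕ) where

  -- x₁ ^ v₁ ⋯ x_N ^ v_N, N = suc n, is represented by v.
  Exponents : Set
  Exponents = Vec ℕ (suc n)

  _⁺ : Exponents → List ℕ
  v ⁺ = sort (toList v)

  infix 4 _≼_ _⊴_ _◁_ _⊴?_ _◁?_

  _≼_ : List ℕ → List ℕ → Set
  u ≼ v = ∀ (i : Fin (suc n)) → sum (take (suc (toℕ i)) u) ≤ sum (take (suc (toℕ i)) v)

  _⊴_ : Exponents → Exponents → Set
  u ⊴ v = (u ⁺ ≢ v ⁺ × u ⁺ ≼ v ⁺) ⊎ (u ⁺ ≡ v ⁺ × toList u ≼ toList v)

  _◁_ : Exponents → Exponents → Set
  u ◁ v = u ⊴ v × u ≢ v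

  _⊴?_ : ∀ u v → Dec (u ⊴ v)
  u ⊴? v = (¬? (u⁺≟v⁺) ×-dec ≼? (u ⁺) (v ⁺)) ⊎-dec (u⁺≟v⁺ ×-dec ≼? (toList u) (toList v))
    where
    u⁺≟v⁺ = List.≡-dec ℕ._≟_ (u ⁺) (v ⁺)
    ≼? : ∀ u v → Dec (u ≼ v)
    ≼? u v = Fin.all? λ i → sum (take (suc (toℕ i)) u) ℕ.≤? sum (take (suc (toℕ i)) v)

  _◁?_ : ∀ u v → Dec (u ◁ v)
  u ◁? v = u ⊴? v ×-dec ¬? (Vec.≡-dec ℕ._≟_ u v)

  private
    -- All vectors of length k with entries at most b.
    box : ∀ k → ℕ → List (Vec ℕ k)
    box zero    b = [] ∷ []
    box (suc k) b = cartesianProductWith _∷_ (upTo (suc b)) (box k b)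

    box-unique : ∀ k b → Unique (box k b)
    box-unique zero    b = All.[] AllPairs.∷ AllPairs.[]
    box-unique (suc k) b =
      Unique.cartesianProductWith⁺ _∷_ Vec.∷-injective (Unique.upTo⁺ (suc b)) (box-unique k b)

    ∈-box : ∀ {k} (v : Vec ℕ k) {b} → sum (toList v) ≤ b → v ∈ box k b
    ∈-box []      _ = here refl
    ∈-box (a ∷ v) p = ∈-cartesianProductWith⁺ _∷_
      (∈-upTo⁺ (s≤s (ℕ.≤-trans (ℕ.m≤m+n a _) p))) (∈-box v (ℕ.≤-trans (ℕ.m≤n+m _ a) p))

    sum-⁺ : ∀ v → sum (v ⁺) ≡ sum (toList v)
    sum-⁺ v = sum-↭ (sort-↭ (toList v))

    length-⁺ : ∀ v → length (v ⁺) ≡ suc n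
    length-⁺ v = ≡.trans (↭-length (sort-↭ (toList v))) (Vec.length-toList v)

    ≼⇒sum≤ : ∀ u v → length u ≡ suc n → length v ≡ suc n → u ≼ v → sum u ≤ sum v
    ≼⇒sum≤ u v |u| |v| u≼v = subst₂ _≤_ (whole u |u|) (whole v |v|) (u≼v (Fin.fromℕ n))
      where
      whole : ∀ w → length w ≡ suc n → sum (take (suc (toℕ (Fin.fromℕ n))) w) ≡ sum w
      whole w |w| = cong sum (List.take-all _ w
        (ℕ.≤-reflexive (≡.trans |w| (cong suc (≡.sym (Fin.toℕ-fromℕ n))))))

    ⊴⇒sum≤ : ∀ {u v} → u ⊴ v → sum (toList u) ≤ sum (toList v)
    ⊴⇒sum≤ {u} {v} (inj₁ (_ , p)) =
      subst₂ _≤_ (sum-⁺ u) (sum-⁺ v) (≼⇒sum≤ (u ⁺) (v ⁺) (length-⁺ u) (length-⁺ v) p)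
    ⊴⇒sum≤ {u} {v} (inj₂ (_ , p)) = ≼⇒sum≤ (toList u) (toList v) (Vec.length-toList u) (Vec.length-toList v) p

  below : Exponents → List Exponents
  below v = filter (_◁? v) (box (suc n) (sum (toList v)))

  below-unique : ∀ v → Unique (below v)
  below-unique v = Unique.filter⁺ (_◁? v) (box-unique (suc n) _)

  ∈-below : ∀ {u v} → u ∈ below v ⇔ u ◁ v
  ∈-below {u} {v} = mk⇔
    (λ p → proj₂ (∈-filter⁻ (_◁? v) {xs = box (suc n) _} p))
    (λ p → ∈-filter⁺ (_◁? v) (∈-box u (⊴⇒sum≤ (proj₁ p))) p)

------------------------------------------------------------------------
-- Polynomials in x_1, …, x_N and divided differences

private
  shiftᴵ : ∀ {n} (i : Fin n) (v : Vec ℕ (suc n)) a b →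
    zipWith ℕ._+_ (replicate (suc n) 0 [ inject₁ i ]≔ 1) (v [ inject₁ i ]≔ a [ suc i ]≔ b)
      ≡ v [ inject₁ i ]≔ suc a [ suc i ]≔ b
  shiftᴵ zero    (_ ∷ _ ∷ v) a b = cong (λ v → suc a ∷ b ∷ v) (Vec.zipWith-identityˡ ℕ.+-identityˡ v)
  shiftᴵ (suc i) (e ∷ v)     a b = cong (e ∷_) (shiftᴵ i v a b)

  shiftᴶ : ∀ {n} (i : Fin n) (v : Vec ℕ (suc n)) a b →
    zipWith ℕ._+_ (replicate (suc n) 0 [ suc i ]≔ 1) (v [ inject₁ i ]≔ a [ suc i ]≔ b)
      ≡ v [ inject₁ i ]≔ a [ suc i ]≔ suc b
  shiftᴶ zero    (_ ∷ _ ∷ v) a b = cong (λ v → a ∷ suc b ∷ v) (Vec.zipWith-identityˡ ℕ.+-identityˡ v)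
  shiftᴶ (suc i) (e ∷ v)     a b = cong (e ∷_) (shiftᴶ i v a b)

  restore : ∀ {n} (i : Fin n) (v : Vec ℕ (suc n)) →
    v [ inject₁ i ]≔ lookup v (inject₁ i) [ suc i ]≔ lookup v (suc i) ≡ v
  restore i v = ≡.trans (cong (_[ suc i ]≔ lookup v (suc i)) (Vec.[]≔-lookup v (inject₁ i)))
                        (Vec.[]≔-lookup v (suc i))

module Polynomials {c ℓ} (R : CommutativeRing c ℓ) (n : ℕ) where
  open CommutativeRing R renaming (refl to ≈-refl)
  open FreeModule R
  open Orders n
  open Equality (≡.decSetoid (Vec.≡-dec {n = suc n} ℕ._≟_)) public
    renaming (coeff to coeffᵖ; _≋_ to _≋ᵖ_)

  Poly : Set c
  Poly = Free Exponents

  x^_ : Exponents → Poly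
  x^ v = basis v

  X : Fin (suc n) → Poly
  X k = x^ (replicate (suc n) 0 [ k ]≔ 1)

  infixl 7 _·_

  _·_ : Poly → Poly → Poly
  _·_ = cartesianProductWith λ (k , u) (l , v) → k * l , zipWith ℕ._+_ u v

  module _ (i : Fin n) where

    -- v with its exponents at x_i, x_{i+1} replaced by a, b
    _⟨_,_⟩ : Exponents → ℕ → ℕ → Exponents
    v ⟨ a , b ⟩ = v [ inject₁ i ]≔ a [ suc i ]≔ b

    swap : Exponents → Exponents
    swap v = v ⟨ lookup v (suc i) , lookup v (inject₁ i) ⟩

    -- (p - p^{s_i}) / (x_i - x_{i+1}) for p = x^v
    ∂ : Exponents → Poly
    ∂ v = applyUpTo (λ k → 1#   , v ⟨ a ∸ suc k , b ℕ.+ k ⟩) (a ∸ b)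
       ++ applyUpTo (λ k → - 1# , v ⟨ a ℕ.+ k , b ∸ suc k ⟩) (b ∸ a)
      where
      a b : ℕ
      a = lookup v (inject₁ i)
      b = lookup v (suc i)

    ∂-correct : ∀ v → (X (inject₁ i) ⊖ X (suc i)) · ∂ v ≋ᵖ x^ v ⊖ x^ swap v
    ∂-correct v w = begin
      coeffᵖ w (map (mul 1# I) (L₊ ++ L₋) ++ (map (mul (- 1# * 1#) J) (L₊ ++ L₋) ++ []))
        ≡⟨ cong (coeffᵖ w) (cong₂ _++_ (List.map-++ _ L₊ L₋)
             (≡.trans (List.++-identityʳ _) (List.map-++ _ L₊ L₋))) ⟩
      coeffᵖ w ((map (mul 1# I) L₊ ++ map (mul 1# I) L₋)
             ++ (map (mul (- 1# * 1#) J) L₊ ++ map (mul (- 1# * 1#) J) L₋))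
        ≈⟨ trans (coeff-++ (map (mul 1# I) L₊ ++ map (mul 1# I) L₋) _)
             (+-cong (coeff-++ (map (mul 1# I) L₊) _) (coeff-++ (map (mul (- 1# * 1#) J) L₊) _)) ⟩
      (coeffᵖ w (map (mul 1# I) L₊) + coeffᵖ w (map (mul 1# I) L₋))
        + (coeffᵖ w (map (mul (- 1# * 1#) J) L₊) + coeffᵖ w (map (mul (- 1# * 1#) J) L₋))
        ≈⟨ interchange _ _ _ _ ⟩
      (coeffᵖ w (map (mul 1# I) L₊) + coeffᵖ w (map (mul (- 1# * 1#) J) L₊))
        + (coeffᵖ w (map (mul 1# I) L₋) + coeffᵖ w (map (mul (- 1# * 1#) J) L₋))
        ≈⟨ +-cong tele₊ (trans (+-comm _ _) tele₋) ⟩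
      (δ (v ⟨ a , b ⟩) - δ (p₊ (a ∸ b))) + (δ (v ⟨ a , b ⟩) - δ (p₋ (b ∸ a)))
        ≈⟨ ends ⟩
      δ v - δ (swap v)
        ≈⟨ +-congˡ (trans (+-identityʳ _) (term-neg _ (*-identityʳ _))) ⟨
      coeffᵖ w (x^ v ⊖ x^ swap v) ∎
      where
      open import Relation.Binary.Reasoning.Setoid setoid
      open RingProperties ring using (-1*x≈-x; -0#≈0#; -‿involutive)
      open import Algebra.Properties.CommutativeSemigroup +-commutativeSemigroup using (interchange)

      I J : Exponents
      I = replicate (suc n) 0 [ inject₁ i ]≔ 1
      J = replicate (suc n) 0 [ suc i ]≔ 1
      a b : ℕ
      a = lookup v (inject₁ i)
      b = lookup v (suc i)
      t₊ t₋ p₊ p₋ : ℕ → Exponents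
      t₊ k = v ⟨ a ∸ suc k , b ℕ.+ k ⟩
      t₋ k = v ⟨ a ℕ.+ k , b ∸ suc k ⟩
      p₊ k = v ⟨ a ∸ k , b ℕ.+ k ⟩
      p₋ k = v ⟨ a ℕ.+ k , b ∸ k ⟩
      L₊ L₋ : Poly
      L₊ = applyUpTo (λ k → 1# , t₊ k) (a ∸ b)
      L₋ = applyUpTo (λ k → - 1# , t₋ k) (b ∸ a)

      mul : Carrier → Exponents → Carrier × Exponents → Carrier × Exponents
      mul k u (l , v) = k * l , zipWith ℕ._+_ u v

      term : Carrier → Exponents → Carrier
      term k u = if does (Vec.≡-dec ℕ._≟_ w u) then k else 0#

      δ : Exponents → Carrier
      δ = term 1#

      coeff-++ : ∀ m m′ → coeffᵖ w (m ++ m′) ≈ coeffᵖ w m + coeffᵖ w m′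
      coeff-++ []            m′ = sym (+-identityˡ _)
      coeff-++ ((k , u) ∷ m) m′ = trans (+-congˡ (coeff-++ m m′)) (sym (+-assoc _ _ _))

      term-one : ∀ {k} u → k ≈ 1# → term k u ≈ δ u
      term-one u p with does (Vec.≡-dec ℕ._≟_ w u)
      ... | true  = p
      ... | false = ≈-refl

      term-neg : ∀ {k} u → k ≈ - 1# → term k u ≈ - δ u
      term-neg u p with does (Vec.≡-dec ℕ._≟_ w u)
      ... | true  = p
      ... | false = sym -0#≈0#

      x-x+y-z : ∀ x y z → (x - y) + (y - z) ≈ x - z
      x-x+y-z x y z = trans (+-assoc _ _ _)
        (+-congˡ (trans (sym (+-assoc _ _ _)) (trans (+-congʳ (-‿inverseˡ y)) (+-identityˡ _))))

      telescope : ∀ {k α β A B} (t p : ℕ → Exponents) d → α * k ≈ 1# → β * k ≈ - 1# →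
        (∀ j → j < d → zipWith ℕ._+_ A (t j) ≡ p j) →
        (∀ j → j < d → zipWith ℕ._+_ B (t j) ≡ p (suc j)) →
        let L = applyUpTo (λ j → k , t j) d in
        coeffᵖ w (map (mul α A) L) + coeffᵖ w (map (mul β B) L) ≈ δ (p 0) - δ (p d)
      telescope t p zero αk βk tA tB = trans (+-identityʳ 0#) (sym (-‿inverseʳ _))
      telescope {k} {α} {β} {A} {B} t p (suc d) αk βk tA tB = begin
        (term (α * k) (zipWith ℕ._+_ A (t 0)) + _) + (term (β * k) (zipWith ℕ._+_ B (t 0)) + _)
          ≈⟨ interchange _ _ _ _ ⟩
        (term (α * k) (zipWith ℕ._+_ A (t 0)) + term (β * k) (zipWith ℕ._+_ B (t 0))) + _
          ≈⟨ +-cong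
               (+-cong (trans (term-one _ αk) (reflexive (cong δ (tA 0 z<s))))
                       (trans (term-neg _ βk) (reflexive (cong (-_ ∘ δ) (tB 0 z<s)))))
               (telescope (t ∘ suc) (p ∘ suc) d αk βk (λ j → tA (suc j) ∘ s<s) (λ j → tB (suc j) ∘ s<s)) ⟩
        (δ (p 0) - δ (p 1)) + (δ (p 1) - δ (p (suc d)))
          ≈⟨ x-x+y-z _ _ _ ⟩
        δ (p 0) - δ (p (suc d)) ∎

      pred : ∀ {x y k} → k < x ∸ y → suc (x ∸ suc k) ≡ x ∸ k
      pred {x} {y} k< = ≡.sym (ℕ.+-∸-assoc 1 (ℕ.≤-trans k< (ℕ.m∸n≤m x y)))

      p₊0 : p₊ 0 ≡ v ⟨ a , b ⟩
      p₊0 = cong (v ⟨ a ,_⟩) (ℕ.+-identityʳ b)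
      p₋0 : p₋ 0 ≡ v ⟨ a , b ⟩
      p₋0 = cong (v ⟨_, b ⟩) (ℕ.+-identityʳ a)

      tele₊ : coeffᵖ w (map (mul 1# I) L₊) + coeffᵖ w (map (mul (- 1# * 1#) J) L₊)
            ≈ δ (v ⟨ a , b ⟩) - δ (p₊ (a ∸ b))
      tele₊ = trans
        (telescope t₊ p₊ (a ∸ b) (*-identityˡ 1#) (trans (*-identityʳ _) (*-identityʳ _))
          (λ k k< → ≡.trans (shiftᴵ i v _ _) (cong (v ⟨_, b ℕ.+ k ⟩) (pred {a} {b} k<)))
          (λ k k< → ≡.trans (shiftᴶ i v _ _) (cong (v ⟨ a ∸ suc k ,_⟩) (≡.sym (ℕ.+-suc b k)))))
        (+-congʳ (reflexive (cong δ p₊0)))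

      tele₋ : coeffᵖ w (map (mul (- 1# * 1#) J) L₋) + coeffᵖ w (map (mul 1# I) L₋)
            ≈ δ (v ⟨ a , b ⟩) - δ (p₋ (b ∸ a))
      tele₋ = trans
        (telescope t₋ p₋ (b ∸ a)
          (trans (*-congʳ (*-identityʳ _)) (trans (-1*x≈-x _) (-‿involutive 1#))) (*-identityˡ _)
          (λ k k< → ≡.trans (shiftᴶ i v _ _) (cong (v ⟨ a ℕ.+ k ,_⟩) (pred {b} {a} k<)))
          (λ k k< → ≡.trans (shiftᴵ i v _ _) (cong (v ⟨_, b ∸ suc k ⟩) (≡.sym (ℕ.+-suc a k)))))
        (+-congʳ (reflexive (cong δ p₋0)))

      v≡ : δ (v ⟨ a , b ⟩) ≈ δ v
      v≡ = reflexive (cong δ (restore i v))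

      ends : (δ (v ⟨ a , b ⟩) - δ (p₊ (a ∸ b))) + (δ (v ⟨ a , b ⟩) - δ (p₋ (b ∸ a))) ≈ δ v - δ (swap v)
      ends with ℕ.≤-total b a
      ... | inj₁ b≤a = trans (+-cong (+-cong v≡ (-‿cong (reflexive (cong δ (cong₂ (v ⟨_,_⟩)
                                 (ℕ.m∸[m∸n]≡n b≤a) (ℕ.m+[n∸m]≡n b≤a))))))
                               (trans (+-congˡ (-‿cong (reflexive (cong δ (≡.trans (cong p₋ (ℕ.m≤n⇒m∸n≡0 b≤a)) p₋0)))))
                                 (-‿inverseʳ _)))
                             (+-identityʳ _)
      ... | inj₂ a≤b = trans (+-cong (trans (+-congˡ (-‿cong (reflexive (cong δ (≡.trans (cong p₊ (ℕ.m≤n⇒m∸n≡0 a≤b)) p₊0)))))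
                                 (-‿inverseʳ _))
                               (+-cong v≡ (-‿cong (reflexive (cong δ (cong₂ (v ⟨_,_⟩)
                                 (ℕ.m+[n∸m]≡n a≤b) (ℕ.m∸[m∸n]≡n a≤b)))))))
                             (+-identityˡ _)

------------------------------------------------------------------------
-- The Hecke algebra

-- Elements of ℋ_N(s), N = suc n, are represented by words in the generators
-- T_1, …, T_n (indexed by Fin n) and the scalars, modulo the congruence generated
-- by the axioms of a unital associative K-algebra, the quadratic relations and the
-- braid relations.

module HeckeAlgebra {c ℓ} (K : CommutativeRing c ℓ) (s : CommutativeRing.Carrier K) (n : ℕ) where
  private module K = CommutativeRing K

  infixl 7 _*_
  infixl 6 _+_
  infix  4 _≈_

  data Word : Set c where
    T      : Fin n → Word
    scalar : K.Carrier → Word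
    _+_    : Word → Word → Word
    _*_    : Word → Word → Word

  data _≈_ : Word → Word → Set (c ⊔ ℓ) where
    ≈-refl      : ∀ {g} → g ≈ g
    ≈-sym       : ∀ {g h} → g ≈ h → h ≈ g
    ≈-trans     : ∀ {f g h} → f ≈ g → g ≈ h → f ≈ h
    +-cong      : ∀ {g g′ h h′} → g ≈ g′ → h ≈ h′ → g + h ≈ g′ + h′
    *-cong      : ∀ {g g′ h h′} → g ≈ g′ → h ≈ h′ → g * h ≈ g′ * h′
    scalar-cong : ∀ {k l} → k K.≈ l → scalar k ≈ scalar l
    +-assoc     : ∀ f g h → (f + g) + h ≈ f + (g + h)
    +-comm      : ∀ g h → g + h ≈ h + g
    +-identity  : ∀ h → scalar K.0# + h ≈ h
    *-assoc     : ∀ f g h → (f * g) * h ≈ f * (g * h)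
    *-identity  : ∀ h → scalar K.1# * h ≈ h
    zero        : ∀ h → scalar K.0# * h ≈ scalar K.0#
    distribˡ    : ∀ f g h → f * (g + h) ≈ f * g + f * h
    distribʳ    : ∀ f g h → (g + h) * f ≈ g * f + h * f
    scalar-+    : ∀ k l → scalar (k K.+ l) ≈ scalar k + scalar l
    scalar-*    : ∀ k l → scalar (k K.* l) ≈ scalar k * scalar l
    central     : ∀ k h → scalar k * h ≈ h * scalar k
    quadratic   : ∀ i → (T i + scalar K.1#) * (T i + scalar (K.- s)) ≈ scalar K.0#
    braid       : ∀ {i j} → toℕ j ≡ suc (toℕ i) → T i * T j * T i ≈ T j * T i * T j
    commute     : ∀ {i j} → suc (toℕ i) < toℕ j → T i * T j ≈ T j * T i

  Hecke : Setoid c (c ⊔ ℓ)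
  Hecke = record
    { Carrier = Word
    ; _≈_ = _≈_
    ; isEquivalence = record { refl = ≈-refl ; sym = ≈-sym ; trans = ≈-trans } }

------------------------------------------------------------------------
-- V_λ and M_λ = K[x_1, …, x_N] ⊗ V_λ for N = suc n

module Modules {a ℓa ℓa# c ℓ ℓ#} {C : HeytingField a ℓa ℓa#}
    (K : RationalFunctionField C c ℓ ℓ#) {n : ℕ} (μ : Partition (suc n)) where
  open RationalFunctionField K using (commutativeRing; Carrier; _+_; _*_; _-_; -_; 1#; _^_; q; s)
  open Coefficients K using (s⁻¹; diag; offDiag)
  open FreeModule commutativeRing public
  open Orders n public
  open Polynomials commutativeRing n public using (Poly; x^_; X; _·_; swap; ∂)
  open HeckeAlgebra commutativeRing s n public using (Hecke; T; scalar)
  open HeckeAlgebra commutativeRing s n using () renaming (Word to HeckeWord; _+_ to _+ᴴ_; _*_ to _*ᴴ_)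

  V : Set c
  V = Free (Tab μ)

  -- 𝕋 T_i.  When i is in a lower row than i + 1, apply the formula to
  -- U = 𝕋^(i,i+1) and solve for 𝕋 T_i = U^(i,i+1) T_i (see remaining-case).
  _T⟨_⟩ : Tab μ → Fin n → V
  𝕋 T⟨ i ⟩ with row (cellOf 𝕋 (inject₁ i)) ℕ.≟ row (cellOf 𝕋 (suc i))
              | col (cellOf 𝕋 (inject₁ i)) ℕ.≟ col (cellOf 𝕋 (suc i))
  ... | yes _ | _     = s • basis 𝕋
  ... | no _  | yes _ = (- 1#) • basis 𝕋
  ... | no r≢ | no c≢ with ℕ.<-cmp (row (cellOf 𝕋 (inject₁ i))) (row (cellOf 𝕋 (suc i)))
  ...   | tri≈ _ r≡ _ = contradiction r≡ r≢
  ...   | tri> _ _ r> = diag m m>0 • basis 𝕋 ⊕ offDiag m m>0 • basis (exchange 𝕋 i r≢ c≢)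
    where
    m = ∣ contentDifference 𝕋 i ∣
    m>0 = higher⇒m>0 𝕋 i r> c≢
  ...   | tri< r< _ _ = (s - 1# - diag m m>0) • basis 𝕋 ⊕ basis U
    where
    U = exchange 𝕋 i r≢ c≢
    m = ∣ contentDifference U i ∣
    m>0 = exchange-m>0 𝕋 i r≢ c≢ r<

  infixl 7 _◃_

  -- The right action of the Hecke algebra on V_λ, computed on representatives.  That
  -- equivalent words act equally is the standard fact that V_λ is a module; it is
  -- not proved here.
  _◃_ : V → Setoid.Carrier Hecke → V
  u ◃ T i         = linear (_T⟨ i ⟩) u
  u ◃ scalar k    = k • u
  u ◃ (g +ᴴ h)    = u ◃ g ⊕ u ◃ h
  u ◃ (g *ᴴ h)    = u ◃ g ◃ h

  M : Set c
  M = Free (Exponents × Tab μ)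

  open Equality (×-decSetoid (≡.decSetoid (Vec.≡-dec {n = suc n} ℕ._≟_)) (Tab-decSetoid μ)) public
    using (coeff; _≋_)

  -- Right operators on M_λ are functions M → M, composed from left to right by
  -- folding over a list of indices.

  𝐓 : M → Fin n → M
  𝐓 m i = linear (λ (v , 𝕋) → ((1# - s) • (X (suc i) · ∂ i v)) ⊗ basis 𝕋
                              ⊕ x^ swap i v ⊗ 𝕋 T⟨ i ⟩) m

  𝐓⁻¹ : M → Fin n → M
  𝐓⁻¹ m i = s⁻¹ • (𝐓 m i ⊕ (1# - s) • m)

  -- p(q x_N, x_1, …, x_{N-1}) = q^{v₁} x_1^{v₂} ⋯ x_{N-1}^{v_N} x_N^{v₁} for p = x^v.
  𝐰 : M → M
  𝐰 = linear λ { (v₁ ∷ v , 𝕋) →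
        ((q ^ v₁) • (x^ (v ∷ʳ v₁))) ⊗ foldl (λ u i → u ◃ T i) (basis 𝕋) (allFin n) }

  -- Here j - 1 = toℕ j, N - j = n ∸ toℕ j, and T_k is the generator with
  -- toℕ equal to k - 1.
  Ξ : M → Fin (suc n) → M
  Ξ m j = (s⁻¹ ^ (n ∸ toℕ j)) • foldl 𝐓 (𝐰 (foldl 𝐓⁻¹ m [j-1⋯1])) [N-1⋯j]
    where
    [N-1⋯1] [j-1⋯1] [N-1⋯j] : List (Fin n)
    [N-1⋯1] = reverse (allFin n)
    [j-1⋯1] = filter (λ i → toℕ i ℕ.<? toℕ j) [N-1⋯1]
    [N-1⋯j] = filter (λ i → toℕ j ℕ.≤? toℕ i) [N-1⋯1]

module Submission where

open import Level as Level using (Level)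
open import Algebra.Apartness.Bundles using (HeytingField)
open import Algebra.Bundles using (CommutativeRing)
import Algebra.Properties.CommutativeSemigroup as CommutativeSemigroupProperties
import Algebra.Properties.Ring as RingProperties
open import Data.Bool.Base using (if_then_else_; true; false)
open import Data.Empty using (⊥)
open import Data.Fin.Base using (Fin; zero; suc; toℕ; fromℕ; inject₁)
import Data.Fin.Properties as Fin
open import Data.List.Base as List
  using (List; []; _∷_; _++_; map; take; filter; foldl; reverse; allFin; applyUpTo)
open import Data.List.Membership.Propositional using (_∈_)
import Data.List.Properties as List
open import Data.List.Relation.Binary.Permutation.Propositional
  using (_↭_; ↭-refl; ↭-reflexive; ↭-sym; ↭-trans; prep; ↭⇒↭ₛ)
  renaming (swap to ↭-swap)
import Data.List.Relation.Binary.Permutation.Propositional.Properties as ↭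
import Data.List.Relation.Binary.Pointwise as Pointwise
open import Data.List.Relation.Unary.All as All using (All; []; _∷_)
import Data.List.Relation.Unary.All.Properties as All
open import Data.List.Relation.Unary.AllPairs using (AllPairs; []; _∷_)
open import Data.List.Relation.Unary.Any using (here; there)
import Data.List.Relation.Unary.Linked.Properties as Linked
import Data.List.Relation.Unary.Sorted.TotalOrder.Properties as Sorted
open import Data.List.Relation.Unary.Unique.Propositional using (Unique)
open import Data.Nat.Base as ℕ using (ℕ; zero; suc; _∸_; _≤_; _<_; _≥_; z≤n; s≤s; s≤s⁻¹)
open import Data.Nat.ListAction using (sum)
open import Data.Nat.ListAction.Properties using (sum-↭)
import Data.Nat.Properties as ℕ
open import Data.Product.Base using (∃; ∃₂; _×_; _,_; proj₁; proj₂)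
open import Data.Sum.Base using (_⊎_; inj₁; inj₂)
open import Data.Vec.Base as Vec
  using (Vec; []; _∷_; _∷ʳ_; lookup; toList; replicate; zipWith; insertAt; removeAt; _[_]≔_)
import Data.Vec.Properties as Vec
open import Function.Base using (_∘_)
open import Function.Bundles using (module Equivalence)
open import Relation.Binary.Bundles using (DecSetoid; Setoid)
import Relation.Binary.Properties.DecTotalOrder ℕ.≤-decTotalOrder as ≥
open import Relation.Binary.PropositionalEquality as ≡ using (_≡_; _≢_; refl)
open import Relation.Nullary using (Dec; yes; no; does; contradiction)
open import Relation.Unary using (Pred; Decidable)
open import Data.List.Sort ≥.≥-decTotalOrder using (sort; sort-↭; sort-↗)
open import Defs

-- Up to vectors whose decreasing rearrangement is strictly smaller, T_i and T_i⁻¹ either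
-- exchange the exponents of x_i, x_{i+1} or leave them alone; T_i leaves them alone only
-- if v_i < v_{i+1}, and T_i⁻¹ only if v_i ≥ v_{i+1}, because for v_i < v_{i+1} the term x^v
-- of the divided difference cancels against the scalar part of T_i⁻¹.  Follow the entry
-- that Ξ_j moves from position j to the front, by the rotation to the back, and down to
-- position j again.  Whenever a factor leaves the exponents alone, the travelling entry
-- changes places with the one it should have passed, so entries before j only decrease,
-- entries after j only increase, and the total is preserved: all partial sums decrease.
-- The strictly smaller rearrangements are recognised through the sums Σ max(v_k - t, 0),
-- since the sum of the k largest entries is the minimum over t of k t + Σ max(v_k - t, 0).
-- On the tableau side every step multiplies by a Hecke word.

module Combinatorics where
  open import Data.Nat.Base using (_+_; _*_; _⊔_)
  open ≡ using (sym; trans; cong; cong₂; subst; subst₂; module ≡-Reasoning)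
  open CommutativeSemigroupProperties ℕ.+-commutativeSemigroup using (interchange)

  -- Excess sums and partial sums of decreasing rearrangements.

  excess : ℕ → List ℕ → ℕ
  excess t = sum ∘ map (_∸ t)

  excess-↭ : ∀ {l m} t → l ↭ m → excess t l ≡ excess t m
  excess-↭ t = sum-↭ ∘ ↭.map⁺ (_∸ t)

  infix 4 _⊑_ _⊏_

  -- This is weak majorization, tested on the functions max(x - t, 0). Being a record, it lets both
  -- lists be inferred from a proof.
  record _⊑_ (l m : List ℕ) : Set where
    constructor mk⊑
    field excess≤ : ∀ t → excess t l ≤ excess t m

  -- One threshold with strict inequality separates the two multisets, since excess sums are
  -- invariant under permutation.
  record _⊏_ (l m : List ℕ) : Set where
    constructor mk⊏
    field
      ⊏⇒⊑     : l ⊑ m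
      t       : ℕ
      excess< : excess t l < excess t m

  open _⊑_
  open _⊏_ using (⊏⇒⊑)

  ↭⇒⊑ : ∀ {l m} → l ↭ m → l ⊑ m
  ↭⇒⊑ p = mk⊑ λ t → ℕ.≤-reflexive (excess-↭ t p)

  ⊑-trans : ∀ {k l m} → k ⊑ l → l ⊑ m → k ⊑ m
  ⊑-trans (mk⊑ p) (mk⊑ q) = mk⊑ λ t → ℕ.≤-trans (p t) (q t)

  ⊑-⊏-trans : ∀ {k l m} → k ⊑ l → l ⊏ m → k ⊏ m
  ⊑-⊏-trans k⊑l (mk⊏ l⊑m t l<m) = mk⊏ (⊑-trans k⊑l l⊑m) t (ℕ.≤-<-trans (excess≤ k⊑l t) l<m)

  ⊏-↭ : ∀ {l m m′} → l ⊏ m → m ↭ m′ → l ⊏ m′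
  ⊏-↭ (mk⊏ l⊑m t l<m) p = mk⊏ (⊑-trans l⊑m (↭⇒⊑ p)) t (ℕ.<-≤-trans l<m (excess≤ (↭⇒⊑ p) t))

  -- Each of the first k entries x is at most t + (x ∸ t), and the excesses of the later entries
  -- only enlarge the right side. With `sum-take≥` this gives the minimum formula for sums of
  -- largest entries.
  sum-take≤ : ∀ t k l → sum (take k l) ≤ k * t + excess t l
  sum-take≤ t zero    l       = z≤n
  sum-take≤ t (suc k) []      = z≤n
  sum-take≤ t (suc k) (x ∷ l) = begin
    x + sum (take k l)                      ≤⟨ ℕ.+-mono-≤ (ℕ.m≤n+m∸n x t) (sum-take≤ t k l) ⟩
    (t + (x ∸ t)) + (k * t + excess t l)    ≡⟨ interchange t (x ∸ t) (k * t) (excess t l) ⟩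
    (t + k * t) + (x ∸ t + excess t l)      ∎
    where open ℕ.≤-Reasoning

  excess-bounded : ∀ {t l} → All (_≤ t) l → excess t l ≡ 0
  excess-bounded []       = refl
  excess-bounded (p ∷ ps) = cong₂ _+_ (ℕ.m≤n⇒m∸n≡0 p) (excess-bounded ps)

  -- The threshold is the (k + 1)-st entry (0 if there is none).
  sum-take≥ : ∀ k {l} → AllPairs _≥_ l →
    ∃ λ t → (∀ {b} → All (_≤ b) l → t ≤ b) × suc k * t + excess t l ≤ sum (take (suc k) l)
  sum-take≥ k []          = 0 , (λ _ → z≤n) , ℕ.≤-reflexive (trans (ℕ.+-identityʳ _) (ℕ.*-zeroʳ k))
  sum-take≥ zero {x ∷ l} (x≥ ∷ _) = x , (λ { (x≤b ∷ _) → x≤b }) , ℕ.≤-reflexive (begin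
    (x + 0) + (x ∸ x + excess x l) ≡⟨ cong (x + 0 +_) (cong₂ _+_ (ℕ.n∸n≡0 x) (excess-bounded x≥)) ⟩
    (x + 0) + 0                    ≡⟨ ℕ.+-identityʳ _ ⟩
    x + 0                          ∎)
    where open ≡-Reasoning
  sum-take≥ (suc k) {x ∷ l} (x≥ ∷ ps) with sum-take≥ k ps
  -- The second component, applied to `x≥`, gives t ≤ x, so that t + (x ∸ t) is x itself.
  ... | t , t≤ , bound = t , (λ { (_ ∷ q) → t≤ q }) , (begin
    (t + suc k * t) + (x ∸ t + excess t l)   ≡⟨ interchange t (suc k * t) (x ∸ t) (excess t l) ⟩
    (t + (x ∸ t)) + (suc k * t + excess t l) ≤⟨ ℕ.+-mono-≤ (ℕ.≤-reflexive (ℕ.m+[n∸m]≡n (t≤ x≥))) bound ⟩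
    x + sum (take (suc k) l)                 ∎)
    where open ℕ.≤-Reasoning

  sort-cong : ∀ {l m} → l ↭ m → sort l ≡ sort m
  sort-cong {l} {m} p = Pointwise.Pointwise-≡⇒≡ (Sorted.↗↭↗⇒≋ ≥.≥-totalOrder (sort-↗ l) (sort-↗ m)
    (↭⇒↭ₛ (↭-trans (sort-↭ l) (↭-trans p (↭-sym (sort-↭ m))))))

  sort-decreasing : ∀ l → AllPairs _≥_ (sort l)
  sort-decreasing l = Linked.Linked⇒AllPairs (λ p q → ℕ.≤-trans q p) (sort-↗ l)

  -- Take the threshold at which the minimum for m is attained: the bound it gives for l is at most
  -- the value for m.
  ⊑⇒sum-take-sort≤ : ∀ {l m} → l ⊑ m → ∀ k → sum (take (suc k) (sort l)) ≤ sum (take (suc k) (sort m))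
  ⊑⇒sum-take-sort≤ {l} {m} l⊑m k with sum-take≥ k (sort-decreasing m)
  ... | t , _ , bound = begin
    sum (take (suc k) (sort l))     ≤⟨ sum-take≤ t (suc k) (sort l) ⟩
    suc k * t + excess t (sort l)   ≡⟨ cong (suc k * t +_) (excess-↭ t (sort-↭ l)) ⟩
    suc k * t + excess t l          ≤⟨ ℕ.+-monoʳ-≤ _ (excess≤ l⊑m t) ⟩
    suc k * t + excess t m          ≡⟨ cong (suc k * t +_) (excess-↭ t (sort-↭ m)) ⟨
    suc k * t + excess t (sort m)   ≤⟨ bound ⟩
    sum (take (suc k) (sort m))     ∎
    where open ℕ.≤-Reasoning

  ∸≤pair : ∀ {x a b} t → x ≤ a ⊔ b → x ∸ t ≤ (a ∸ t) + (b ∸ t)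
  ∸≤pair {x} {a} {b} t x≤ = begin
    x ∸ t              ≤⟨ ℕ.∸-monoˡ-≤ t x≤ ⟩
    (a ⊔ b) ∸ t        ≡⟨ ℕ.∸-distribʳ-⊔ t a b ⟩
    (a ∸ t) ⊔ (b ∸ t)  ≤⟨ ℕ.m⊔n≤m+n (a ∸ t) (b ∸ t) ⟩
    (a ∸ t) + (b ∸ t)  ∎
    where open ℕ.≤-Reasoning

  -- If one new entry is at most t, only the other counts, and it is bounded by the larger old
  -- entry. If both are at least t, nothing is truncated on the left and the equal sums decide.
  transfer-excess≤ : ∀ {a b a′ b′} → a′ + b′ ≡ a + b → a′ ≤ a ⊔ b → b′ ≤ a ⊔ b →
    ∀ t → (a′ ∸ t) + (b′ ∸ t) ≤ (a ∸ t) + (b ∸ t)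
  transfer-excess≤ {a} {b} {a′} {b′} eq a′≤ b′≤ t with ℕ.≤-total a′ t | ℕ.≤-total b′ t
  ... | inj₁ p | _ rewrite ℕ.m≤n⇒m∸n≡0 p = ∸≤pair t b′≤
  ... | inj₂ _ | inj₁ q rewrite ℕ.m≤n⇒m∸n≡0 q | ℕ.+-identityʳ (a′ ∸ t) = ∸≤pair t a′≤
  ... | inj₂ p | inj₂ q = ℕ.+-cancelˡ-≤ (t + t) _ _ (begin
    (t + t) + ((a′ ∸ t) + (b′ ∸ t))   ≡⟨ interchange t t (a′ ∸ t) (b′ ∸ t) ⟩
    (t + (a′ ∸ t)) + (t + (b′ ∸ t))   ≡⟨ cong₂ _+_ (ℕ.m+[n∸m]≡n p) (ℕ.m+[n∸m]≡n q) ⟩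
    a′ + b′                           ≡⟨ eq ⟩
    a + b                             ≤⟨ ℕ.+-mono-≤ (ℕ.m≤n+m∸n a t) (ℕ.m≤n+m∸n b t) ⟩
    (t + (a ∸ t)) + (t + (b ∸ t))     ≡⟨ interchange t t (a ∸ t) (b ∸ t) ⟨
    (t + t) + ((a ∸ t) + (b ∸ t))     ∎)
    where open ℕ.≤-Reasoning

  transfer-⊏ : ∀ {a b a′ b′} l → a′ + b′ ≡ a + b → a′ < a ⊔ b → b′ < a ⊔ b → a′ ∷ b′ ∷ l ⊏ a ∷ b ∷ l
  transfer-⊏ {a} {b} {a′} {b′} l eq a′< b′< = mk⊏ (mk⊑ λ t → begin
    excess t (a′ ∷ b′ ∷ l)               ≡⟨ ℕ.+-assoc (a′ ∸ t) _ _ ⟨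
    (a′ ∸ t) + (b′ ∸ t) + excess t l     ≤⟨ ℕ.+-monoˡ-≤ _ (transfer-excess≤ eq (ℕ.<⇒≤ a′<) (ℕ.<⇒≤ b′<) t) ⟩
    (a ∸ t) + (b ∸ t) + excess t l       ≡⟨ ℕ.+-assoc (a ∸ t) _ _ ⟩
    excess t (a ∷ b ∷ l)                 ∎) t (begin-strict
    excess t (a′ ∷ b′ ∷ l)               ≡⟨ cong₂ _+_ (ℕ.m≤n⇒m∸n≡0 (≤t a′<)) (cong (_+ excess t l) (ℕ.m≤n⇒m∸n≡0 (≤t b′<))) ⟩
    excess t l                           <⟨ ℕ.m<n+m _ pos ⟩
    (a ∸ t) + (b ∸ t) + excess t l       ≡⟨ ℕ.+-assoc (a ∸ t) _ _ ⟩
    excess t (a ∷ b ∷ l)                 ∎)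
    where
    open ℕ.≤-Reasoning
    -- One below the maximum: neither new entry exceeds this threshold, while the larger old entry
    -- does.
    t : ℕ
    t = ℕ.pred (a ⊔ b)
    ≤t : ∀ {x} → x < a ⊔ b → x ≤ t
    ≤t = ℕ.suc[m]≤n⇒m≤pred[n]
    pos : 0 < (a ∸ t) + (b ∸ t)
    pos = ℕ.<-≤-trans
      (ℕ.m<n⇒0<n∸m (ℕ.≤-reflexive (ℕ.suc-pred (a ⊔ b) {{ℕ.>-nonZero (ℕ.≤-<-trans z≤n a′<)}})))
      (∸≤pair t ℕ.≤-refl)

  -- Moves of two adjacent exponents.

  -- An inner move strictly lowers the decreasing rearrangement (transfer-⊏).
  data Move (R : ℕ → ℕ → Set) (a b : ℕ) : ℕ → ℕ → Set where
    swapped : Move R a b b a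
    kept    : R a b → Move R a b a b
    inner   : ∀ {a′ b′} → a′ + b′ ≡ a + b → a′ < a ⊔ b → b′ < a ⊔ b → Move R a b a′ b′

  -- The update behind `swap` and `∂`, restated without a coefficient ring; both unfold to it.
  setAdjacent : ∀ {n} → Fin n → Vec ℕ (suc n) → ℕ → ℕ → Vec ℕ (suc n)
  setAdjacent i u a b = u [ inject₁ i ]≔ a [ suc i ]≔ b

  setAdjacent-restore : ∀ {n} (i : Fin n) u → setAdjacent i u (lookup u (inject₁ i)) (lookup u (suc i)) ≡ u
  setAdjacent-restore i u =
    trans (cong (_[ suc i ]≔ lookup u (suc i)) (Vec.[]≔-lookup u (inject₁ i))) (Vec.[]≔-lookup u (suc i))

  -- The same list l of remaining entries serves for all a and b, so two updates are compared on two
  -- entries only.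
  setAdjacent-↭ : ∀ {n} (i : Fin n) u → ∃ λ l → ∀ a b → toList (setAdjacent i u a b) ↭ a ∷ b ∷ l
  setAdjacent-↭ zero    (_ ∷ _ ∷ u) = toList u , λ _ _ → ↭-refl
  setAdjacent-↭ (suc i) (x ∷ u) with setAdjacent-↭ i u
  ... | l , p = x ∷ l , λ a b → ↭-trans (prep x (p a b)) (↭-sym (↭.shift x (a ∷ b ∷ []) l))

  toList-insertAt-↭ : ∀ {n} (r : Vec ℕ n) k c → toList (insertAt r k c) ↭ c ∷ toList r
  toList-insertAt-↭ r       zero    c = ↭-refl
  toList-insertAt-↭ (x ∷ r) (suc k) c = ↭-trans (prep x (toList-insertAt-↭ r k c)) (↭-swap x c ↭-refl)

  -- The marked position goes down by one: c is overwritten, a becomes the travelling entry and b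
  -- the i-th of the others.
  setAdjacent-insertAt : ∀ {n} (r : Vec ℕ n) i c a b →
    setAdjacent i (insertAt r (suc i) c) a b ≡ insertAt (r [ i ]≔ b) (inject₁ i) a
  setAdjacent-insertAt (x ∷ r) zero    c a b = refl
  setAdjacent-insertAt (x ∷ r) (suc i) c a b = cong (x ∷_) (setAdjacent-insertAt r i c a b)

  lookup-insertAt-suc : ∀ {n} (r : Vec ℕ n) i c → lookup (insertAt r (suc i) c) (inject₁ i) ≡ lookup r i
  lookup-insertAt-suc (x ∷ r) zero    c = refl
  lookup-insertAt-suc (x ∷ r) (suc i) c = lookup-insertAt-suc r i c

  insertAt-fromℕ : ∀ {n} (r : Vec ℕ n) c → insertAt r (fromℕ n) c ≡ r ∷ʳ c
  insertAt-fromℕ []      c = refl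
  insertAt-fromℕ (x ∷ r) c = cong (x ∷_) (insertAt-fromℕ r c)

  x^-setAdjacent : ∀ {n} (i : Fin n) u a b →
    zipWith _+_ (replicate (suc n) 0 [ suc i ]≔ 1) (setAdjacent i u a b) ≡ setAdjacent i u a (suc b)
  x^-setAdjacent zero    (_ ∷ _ ∷ u) a b = cong (λ u → a ∷ suc b ∷ u) (Vec.zipWith-identityˡ ℕ.+-identityˡ u)
  x^-setAdjacent (suc i) (x ∷ u)     a b = cong (x ∷_) (x^-setAdjacent i u a b)

  -- These are the exponents in term k of `X·∂` for y ≤ x. The last term is the exchange; in the
  -- earlier ones both exponents stay below x.
  descending-move : ∀ {R x y} k → y ≤ x → k < x ∸ y → Move R x y (x ∸ suc k) (suc (y + k))
  descending-move {R} {x} {y} k y≤x k< with suc k ℕ.≟ x ∸ y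
  ... | yes eq = subst₂ (Move R x y)
    (sym (trans (cong (x ∸_) eq) (ℕ.m∸[m∸n]≡n y≤x)))
    (sym (trans (sym (ℕ.+-suc y k)) (trans (cong (y +_) eq) (ℕ.m+[n∸m]≡n y≤x))))
    swapped
  ... | no 1+k≢ = inner total
    (ℕ.<-≤-trans (ℕ.∸-monoʳ-< (s≤s z≤n) k<x) (ℕ.m≤m⊔n x y))
    (ℕ.<-≤-trans (subst₂ _<_ (ℕ.+-suc y k) (ℕ.m+[n∸m]≡n y≤x) (ℕ.+-monoʳ-< y (ℕ.≤∧≢⇒< k< 1+k≢))) (ℕ.m≤m⊔n x y))
    where
    k<x : k < x
    k<x = ℕ.≤-trans k< (ℕ.m∸n≤m x y)
    total : x ∸ suc k + suc (y + k) ≡ x + y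
    total = begin
      x ∸ suc k + suc (y + k)   ≡⟨ cong (λ z → x ∸ suc k + suc z) (ℕ.+-comm y k) ⟩
      x ∸ suc k + (suc k + y)   ≡⟨ ℕ.+-assoc (x ∸ suc k) (suc k) y ⟨
      x ∸ suc k + suc k + y     ≡⟨ cong (_+ y) (ℕ.m∸n+n≡m k<x) ⟩
      x + y                     ∎
      where open ≡-Reasoning

  -- These are the exponents in term k + 1 of `X·∂` for x < y. Term 0 is the original monomial and
  -- is split off in `X·∂-ascending`.
  ascending-move : ∀ {R x y} k → x ≤ y → suc k < y ∸ x → Move R x y (x + suc k) (suc (y ∸ suc (suc k)))
  ascending-move {R} {x} {y} k x≤y k< = inner total
    (ℕ.<-≤-trans (subst (x + suc k <_) (ℕ.m+[n∸m]≡n x≤y) (ℕ.+-monoʳ-< x k<)) (ℕ.m≤n⊔m x y))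
    (ℕ.<-≤-trans (subst (_< y) pred-suc (ℕ.∸-monoʳ-< (s≤s z≤n) (ℕ.<⇒≤ k<y))) (ℕ.m≤n⊔m x y))
    where
    k<y : suc k < y
    k<y = ℕ.≤-trans k< (ℕ.m∸n≤m y x)
    pred-suc : y ∸ suc k ≡ suc (y ∸ suc (suc k))
    pred-suc = ℕ.+-∸-assoc 1 k<y
    total : x + suc k + suc (y ∸ suc (suc k)) ≡ x + y
    total = trans (cong (x + suc k +_) (sym pred-suc))
      (trans (ℕ.+-assoc x (suc k) _) (cong (x +_) (ℕ.m+[n∸m]≡n (ℕ.<⇒≤ k<y))))

  -- Shifts of the other entries and their effect on partial sums.

  -- When an entry travels from position j to the front and, after the rotation, from the
  -- back to position j, the other entries can only decrease before j and increase after j.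
  Shift : ∀ {m n} → Fin m → Fin n → ℕ → ℕ → Set
  Shift j p x y = (toℕ p < toℕ j → y ≤ x) × (toℕ j ≤ toℕ p → x ≤ y)

  Shift-refl : ∀ {m n} (j : Fin m) (p : Fin n) {x} → Shift j p x x
  Shift-refl j p = (λ _ → ℕ.≤-refl) , (λ _ → ℕ.≤-refl)

  Shift-trans : ∀ {m n} (j : Fin m) (p : Fin n) {x y z} → Shift j p x y → Shift j p y z → Shift j p x z
  Shift-trans j p (f , g) (f′ , g′) = (λ q → ℕ.≤-trans (f′ q) (f q)) , (λ q → ℕ.≤-trans (g q) (g′ q))

  -- Indices count the entries with position j removed, so an index p ≥ j stands for position p + 1;
  -- hence the weak inequality in the second half of `Shift`.
  Shifts : ∀ {n} → Fin (suc n) → Vec ℕ n → Vec ℕ n → Set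
  Shifts {n} j w r = ∀ p → Shift j p (lookup w p) (lookup r p)

  Shifts-update : ∀ {n} (j : Fin (suc n)) w r i {y} → Shift j i (lookup r i) y → Shifts j w r → Shifts j w (r [ i ]≔ y)
  Shifts-update j w r i {y} s ss p with p Fin.≟ i
  ... | yes refl = subst (Shift j i (lookup w i)) (sym (Vec.lookup∘updateAt i r))
                     (Shift-trans j i (ss i) s)
  ... | no  p≢i  = subst (Shift j p (lookup w p)) (sym (Vec.lookup∘updateAt′ p i p≢i r)) (ss p)

  -- A partial sum is the total minus the omitted tail, and the tails of r are at least those of w.
  -- X and Y stand for entries already passed.
  sum-take-dominated : ∀ {n} m {X Y} (w r : Vec ℕ n) → (∀ p → lookup w p ≤ lookup r p) →
    X + sum (toList r) ≤ Y + sum (toList w) → X + sum (take m (toList r)) ≤ Y + sum (take m (toList w))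
  sum-take-dominated (suc m) []      []      w≤r h = h
  sum-take-dominated zero {X} {Y} w r w≤r h = ℕ.+-monoˡ-≤ 0 (ℕ.+-cancelʳ-≤ (sum (toList r)) X Y
    (ℕ.≤-trans h (ℕ.+-monoʳ-≤ Y (sum-mono w r w≤r))))
    where
    sum-mono : ∀ {n} (w r : Vec ℕ n) → (∀ p → lookup w p ≤ lookup r p) → sum (toList w) ≤ sum (toList r)
    sum-mono []      []      _   = z≤n
    sum-mono (y ∷ w) (x ∷ r) w≤r = ℕ.+-mono-≤ (w≤r zero) (sum-mono w r (w≤r ∘ suc))
  sum-take-dominated (suc m) {X} {Y} (y ∷ w) (x ∷ r) w≤r h =
    subst₂ _≤_ (ℕ.+-assoc X x _) (ℕ.+-assoc Y y _) (sum-take-dominated m w r (w≤r ∘ suc)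
      (subst₂ _≤_ (sym (ℕ.+-assoc X x _)) (sym (ℕ.+-assoc Y y _)) h))

  -- X and Y accumulate the entries already passed.
  sum-take-insertAt : ∀ {n} m (j : Fin (suc n)) {X Y} w r d c → Shifts j w r → X ≤ Y →
    X + sum (toList (insertAt r j c)) ≤ Y + sum (toList (insertAt w j d)) →
    X + sum (take m (toList (insertAt r j c))) ≤ Y + sum (take m (toList (insertAt w j d)))
  sum-take-insertAt zero    j       w       r       d c ss X≤Y h = ℕ.+-monoˡ-≤ 0 X≤Y
  -- Before position j the entries decrease, which maintains X ≤ Y; from j on they increase, and the
  -- comparison starts from the totals instead.
  sum-take-insertAt (suc m) zero {X} {Y} w r d c ss X≤Y h =
    subst₂ _≤_ (ℕ.+-assoc X c _) (ℕ.+-assoc Y d _) (sum-take-dominated m w r (λ p → proj₂ (ss p) z≤n)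
      (subst₂ _≤_ (sym (ℕ.+-assoc X c _)) (sym (ℕ.+-assoc Y d _)) h))
  sum-take-insertAt (suc m) (suc j) {X} {Y} (y ∷ w) (x ∷ r) d c ss X≤Y h =
    subst₂ _≤_ (ℕ.+-assoc X x _) (ℕ.+-assoc Y y _) (sum-take-insertAt m j w r d c
      (λ p → proj₁ (ss (suc p)) ∘ s≤s , proj₂ (ss (suc p)) ∘ s≤s)
      (ℕ.+-mono-≤ X≤Y (proj₁ (ss zero) ℕ.z<s))
      (subst₂ _≤_ (sym (ℕ.+-assoc X x _)) (sym (ℕ.+-assoc Y y _)) h))

  -- Exponent vectors reachable from v.

  module _ {n : ℕ} (v : Vec ℕ (suc n)) (j : Fin (suc n)) where
    open Orders n

    -- c is the travelling entry, r the others.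
    record Travelling (k : Fin (suc n)) (u : Vec ℕ (suc n)) : Set where
      constructor travelling
      field
        {c}    : ℕ
        {r}    : Vec ℕ n
        u≡     : u ≡ insertAt r k c
        perm   : toList u ↭ toList v
        shifts : Shifts j (removeAt v j) r

    -- The first alternative is absorbing, as no move and no rotation raises an excess sum. The
    -- second follows positions while the multiset of entries is still that of v.
    Reachable : Fin (suc n) → Vec ℕ (suc n) → Set
    Reachable k u = toList u ⊏ toList v ⊎ Travelling k u

    Reachable-start : Reachable j v
    Reachable-start = inj₂ (travelling (sym (Vec.insertAt-removeAt v j)) ↭-refl (λ p → Shift-refl j p))

    -- An exchange lets the travelling entry pass and leaves the others as they were. A kept pair
    -- changes roles: the i-th other entry goes from x to y, which `R⇒` certifies as an allowed
    -- shift.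
    Reachable-step : ∀ {R i u a b} → (∀ {x y} → R x y → Shift j i x y) → Reachable (suc i) u →
      Move R (lookup u (inject₁ i)) (lookup u (suc i)) a b → Reachable (inject₁ i) (setAdjacent i u a b)
    Reachable-step {R} {i} {u} {a} {b} R⇒ ρ move = go ρ move
      where
      l : List ℕ
      l = proj₁ (setAdjacent-↭ i u)
      new : ∀ a b → toList (setAdjacent i u a b) ↭ a ∷ b ∷ l
      new = proj₂ (setAdjacent-↭ i u)
      old : lookup u (inject₁ i) ∷ lookup u (suc i) ∷ l ↭ toList u
      old = ↭-trans (↭-sym (new _ _)) (↭-reflexive (cong toList (setAdjacent-restore i u)))

      swapped-↭ : toList (setAdjacent i u (lookup u (suc i)) (lookup u (inject₁ i))) ↭ toList u
      swapped-↭ = ↭-trans (new _ _) (↭-trans (↭-swap _ _ ↭-refl) old)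
      kept-↭ : toList (setAdjacent i u (lookup u (inject₁ i)) (lookup u (suc i))) ↭ toList u
      kept-↭ = ↭-trans (new _ _) old
      inner-⊏ : ∀ {a b} → a + b ≡ lookup u (inject₁ i) + lookup u (suc i) →
        a < lookup u (inject₁ i) ⊔ lookup u (suc i) → b < lookup u (inject₁ i) ⊔ lookup u (suc i) →
        toList (setAdjacent i u a b) ⊏ toList u
      inner-⊏ eq a< b< = ⊏-↭ (⊑-⊏-trans (↭⇒⊑ (new _ _)) (transfer-⊏ l eq a< b<)) old

      travel : ∀ {a b} (τ : Travelling (suc i) u) → toList (setAdjacent i u a b) ↭ toList u →
        Shift j i (lookup u (inject₁ i)) b → Travelling (inject₁ i) (setAdjacent i u a b)
      travel {a} {b} (travelling {c} {r} refl p ss) q s =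
        travelling (setAdjacent-insertAt r i c a b) (↭-trans q p)
          (Shifts-update j (removeAt v j) r i (subst (λ x → Shift j i x b) (lookup-insertAt-suc r i c) s) ss)

      go : ∀ {a b} → Reachable (suc i) u → Move R (lookup u (inject₁ i)) (lookup u (suc i)) a b →
        Reachable (inject₁ i) (setAdjacent i u a b)
      go (inj₁ u⊏v) swapped           = inj₁ (⊑-⊏-trans (↭⇒⊑ swapped-↭) u⊏v)
      go (inj₁ u⊏v) (kept _)          = inj₁ (⊑-⊏-trans (↭⇒⊑ kept-↭) u⊏v)
      go (inj₁ u⊏v) (inner eq a< b<)  = inj₁ (⊑-⊏-trans (⊏⇒⊑ (inner-⊏ eq a< b<)) u⊏v)
      go (inj₂ τ)   (inner eq a< b<)  = inj₁ (⊏-↭ (inner-⊏ eq a< b<) (Travelling.perm τ))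
      go (inj₂ τ)   swapped           = inj₂ (travel τ swapped-↭ (Shift-refl j i))
      go (inj₂ τ)   (kept xRy)        = inj₂ (travel τ kept-↭ (R⇒ xRy))

    Reachable-rotate : ∀ {c r} → Reachable zero (c ∷ r) → Reachable (fromℕ n) (r ∷ʳ c)
    Reachable-rotate {c} {r} = λ
      { (inj₁ u⊏v)                    → inj₁ (⊑-⊏-trans (↭⇒⊑ rotate-↭) u⊏v)
      ; (inj₂ (travelling refl p ss)) → inj₂ (travelling (sym (insertAt-fromℕ r c)) (↭-trans rotate-↭ p) ss) }
      where
      rotate-↭ : toList (r ∷ʳ c) ↭ c ∷ toList r
      rotate-↭ = ↭-trans (↭-reflexive (cong toList (sym (insertAt-fromℕ r c)))) (toList-insertAt-↭ r (fromℕ n) c)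

    -- The alternatives of `Reachable` match those of `⊴`: a strict excess makes the rearrangements
    -- differ, and an equal multiset leaves the comparison of partial sums.
    Reachable-end : ∀ {u} → Reachable j u → u ⊴ v
    Reachable-end {u} (inj₁ (mk⊏ u⊑v t u<v)) = inj₁
      ( (λ u⁺≡v⁺ → ℕ.<-irrefl (trans (sym (excess-↭ t (sort-↭ (toList u))))
                    (trans (cong (excess t) u⁺≡v⁺) (excess-↭ t (sort-↭ (toList v))))) u<v)
      , ⊑⇒sum-take-sort≤ u⊑v ∘ toℕ )
    Reachable-end {u} (inj₂ (travelling {c} {r} refl p ss)) = inj₂ (sort-cong p , λ k →
      subst (λ v → sum (take (suc (toℕ k)) (toList u)) ≤ sum (take (suc (toℕ k)) (toList v))) v≡
        (sum-take-insertAt (suc (toℕ k)) j (removeAt v j) r (lookup v j) c ss z≤n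
          (ℕ.≤-reflexive (trans (sum-↭ p) (cong (sum ∘ toList) (sym v≡))))))
      where
      v≡ : insertAt (removeAt v j) j (lookup v j) ≡ v
      v≡ = Vec.insertAt-removeAt v j

  -- The order of the factors in Ξ_j.

  -- The i-th factor takes the travelling entry from position suc i to inject₁ i.
  data Descends : ∀ {n} → Fin (suc n) → List (Fin n) → Fin (suc n) → Set where
    []  : ∀ {n} {k : Fin (suc n)} → Descends k [] k
    _∷_ : ∀ {n} (i : Fin n) {l k} → Descends (inject₁ i) l k → Descends (suc i) (i ∷ l) k

  Descends-map-suc : ∀ {n} {k k′ : Fin (suc n)} {l} → Descends k l k′ → Descends (suc k) (map suc l) (suc k′)
  Descends-map-suc []      = []
  Descends-map-suc (i ∷ d) = suc i ∷ Descends-map-suc d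

  Descends-∷ʳ : ∀ {n} {k : Fin (suc (suc n))} {l} → Descends k l (suc zero) → Descends k (l ++ zero ∷ []) zero
  Descends-∷ʳ []      = zero ∷ []
  Descends-∷ʳ (i ∷ d) = i ∷ Descends-∷ʳ d

  reverse-allFin-suc : ∀ n → reverse (allFin (suc n)) ≡ map suc (reverse (allFin n)) ++ zero ∷ []
  reverse-allFin-suc n = begin
    reverse (zero ∷ List.tabulate suc)          ≡⟨ List.unfold-reverse zero (List.tabulate suc) ⟩
    reverse (List.tabulate suc) ++ zero ∷ []    ≡⟨ cong (λ l → reverse l ++ zero ∷ []) (List.map-tabulate (λ i → i) suc) ⟨
    reverse (map suc (allFin n)) ++ zero ∷ []   ≡⟨ cong (_++ zero ∷ []) (List.reverse-map suc (allFin n)) ⟨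
    map suc (reverse (allFin n)) ++ zero ∷ []   ∎
    where open ≡-Reasoning

  filter-map : ∀ {a b p} {A : Set a} {B : Set b} {P : Pred B p} (P? : Decidable P) (f : A → B) l →
    filter P? (map f l) ≡ map f (filter (P? ∘ f) l)
  filter-map P? f []      = refl
  filter-map P? f (x ∷ l) with does (P? (f x))
  ... | true  = cong (f x ∷_) (filter-map P? f l)
  ... | false = filter-map P? f l

  -- Index 0 comes last in the reversed list; splitting it off turns the rest into the list for n
  -- with shifted indices.
  filter-reverse-allFin-suc : ∀ {n p} {P : Pred (Fin (suc n)) p} (P? : Decidable P) →
    filter P? (reverse (allFin (suc n))) ≡ map suc (filter (P? ∘ suc) (reverse (allFin n))) ++ filter P? (zero ∷ [])
  filter-reverse-allFin-suc {n} P? = begin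
    filter P? (reverse (allFin (suc n)))
      ≡⟨ cong (filter P?) (reverse-allFin-suc n) ⟩
    filter P? (map suc (reverse (allFin n)) ++ zero ∷ [])
      ≡⟨ List.filter-++ P? (map suc (reverse (allFin n))) (zero ∷ []) ⟩
    filter P? (map suc (reverse (allFin n))) ++ filter P? (zero ∷ [])
      ≡⟨ cong (_++ filter P? (zero ∷ [])) (filter-map P? suc (reverse (allFin n))) ⟩
    map suc (filter (P? ∘ suc) (reverse (allFin n))) ++ filter P? (zero ∷ []) ∎
    where open ≡-Reasoning

  Descends-below : ∀ n (j : Fin (suc n)) → Descends j (filter (λ i → toℕ i ℕ.<? toℕ j) (reverse (allFin n))) zero
  Descends-below n       zero    = subst (λ l → Descends zero l zero)
    (sym (List.filter-none (λ i → toℕ i ℕ.<? 0) (All.universal (λ _ ()) (reverse (allFin n))))) []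
  Descends-below (suc n) (suc j) = subst (λ l → Descends (suc j) l zero)
    (sym (trans (filter-reverse-allFin-suc (λ i → toℕ i ℕ.<? suc (toℕ j)))
      (cong₂ (λ l m → map suc l ++ m) (List.filter-≐ _ (λ i → toℕ i ℕ.<? toℕ j) (s≤s⁻¹ , s≤s) (reverse (allFin n)))
        (List.filter-accept (λ i → toℕ i ℕ.<? suc (toℕ j)) {zero} {[]} ℕ.z<s))))
    (Descends-∷ʳ (Descends-map-suc (Descends-below n j)))

  -- For j > 0 index 0 is rejected, so the walk from the back stops at j. In `Descends-below` it is
  -- accepted instead, and the walk reaches the front.
  Descends-above : ∀ n (j : Fin (suc n)) → Descends (fromℕ n) (filter (λ i → toℕ j ℕ.≤? toℕ i) (reverse (allFin n))) j
  Descends-above zero    zero    = []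
  Descends-above (suc n) zero    = subst (λ l → Descends (suc (fromℕ n)) l zero)
    (sym (trans (filter-reverse-allFin-suc (λ i → 0 ℕ.≤? toℕ i))
      (cong (λ l → map suc l ++ zero ∷ []) (List.filter-≐ _ (λ i → 0 ℕ.≤? toℕ i) ((λ _ → z≤n) , (λ _ → z≤n)) (reverse (allFin n))))))
    (Descends-∷ʳ (Descends-map-suc (Descends-above n zero)))
  Descends-above (suc n) (suc j) = subst (λ l → Descends (suc (fromℕ n)) l (suc j))
    (sym (trans (filter-reverse-allFin-suc (λ i → suc (toℕ j) ℕ.≤? toℕ i))
      (trans (cong₂ (λ l m → map suc l ++ m) (List.filter-≐ _ (λ i → toℕ j ℕ.≤? toℕ i) (s≤s⁻¹ , s≤s) (reverse (allFin n)))
        (List.filter-reject (λ i → suc (toℕ j) ℕ.≤? toℕ i) {zero} {[]} λ ())) (List.++-identityʳ _))))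
    (Descends-map-suc (Descends-above n j))

open Combinatorics

-- Linear functionals on free modules.

-- A linear functional separates more than the coefficients do: f need not respect the
-- setoid equality of the basis, so that _≃_ refines _≋_ and is preserved by every map
-- defined on the basis.
module Functionals {c ℓ} (R : CommutativeRing c ℓ) where
  open CommutativeRing R renaming (refl to ≈-refl)
  open FreeModule R
  open import Relation.Binary.Reasoning.Setoid setoid
  open CommutativeSemigroupProperties +-commutativeSemigroup using (interchange)
  open CommutativeSemigroupProperties *-commutativeSemigroup using (x∙yz≈y∙xz)

  private variable
    a b d : Level
    A : Set a
    B : Set b
    D : Set d

  ⟪_,_⟫ : Free B → (B → Carrier) → Carrier
  ⟪ []          , f ⟫ = 0#
  ⟪ (k , b) ∷ m , f ⟫ = k * f b + ⟪ m , f ⟫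

  infix 4 _≃_
  record _≃_ {B : Set b} (m m′ : Free B) : Set (c Level.⊔ ℓ Level.⊔ b) where
    constructor mk≃
    field at : ∀ f → ⟪ m , f ⟫ ≈ ⟪ m′ , f ⟫
  open _≃_ public

  ≃-trans : {m m′ m″ : Free B} → m ≃ m′ → m′ ≃ m″ → m ≃ m″
  ≃-trans p q = mk≃ λ f → trans (at p f) (at q f)

  pairing-cong : ∀ (m : Free B) {f g} → (∀ b → f b ≈ g b) → ⟪ m , f ⟫ ≈ ⟪ m , g ⟫
  pairing-cong []            p = ≈-refl
  pairing-cong ((k , b) ∷ m) p = +-cong (*-congˡ (p b)) (pairing-cong m p)

  pairing-⊕ : ∀ (m m′ : Free B) f → ⟪ m ⊕ m′ , f ⟫ ≈ ⟪ m , f ⟫ + ⟪ m′ , f ⟫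
  pairing-⊕ []            m′ f = sym (+-identityˡ _)
  pairing-⊕ ((k , b) ∷ m) m′ f = trans (+-congˡ (pairing-⊕ m m′ f)) (sym (+-assoc _ _ _))

  pairing-• : ∀ k (m : Free B) f → ⟪ k • m , f ⟫ ≈ k * ⟪ m , f ⟫
  pairing-• k []            f = sym (zeroʳ k)
  pairing-• k ((l , b) ∷ m) f = trans (+-cong (*-assoc k l _) (pairing-• k m f)) (sym (distribˡ k _ _))

  pairing-basis : ∀ (b : B) f → ⟪ basis b , f ⟫ ≈ f b
  pairing-basis b f = trans (+-identityʳ _) (*-identityˡ _)

  pairing-linear : ∀ (g : B → Free D) m f → ⟪ linear g m , f ⟫ ≈ ⟪ m , (λ b → ⟪ g b , f ⟫) ⟫
  pairing-linear g []            f = ≈-refl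
  pairing-linear g ((k , b) ∷ m) f =
    trans (pairing-⊕ (k • g b) _ f) (+-cong (pairing-• k (g b) f) (pairing-linear g m f))

  pairing-⊗ : ∀ (m : Free B) (m′ : Free D) f → ⟪ m ⊗ m′ , f ⟫ ≈ ⟪ m , (λ b → ⟪ m′ , (λ d → f (b , d)) ⟫) ⟫
  pairing-⊗ []            m′ f = ≈-refl
  pairing-⊗ {B = B} {D = D} ((k , b) ∷ m) m′ f =
    trans (pairing-⊕ (map scale m′) (m ⊗ m′) f) (+-cong (scaled m′) (pairing-⊗ m m′ f))
    where
    scale : Carrier × D → Carrier × B × D
    scale (l , d) = k * l , b , d
    scaled : ∀ m′ → ⟪ map scale m′ , f ⟫ ≈ k * ⟪ m′ , (λ d → f (b , d)) ⟫
    scaled []             = sym (zeroʳ k)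
    scaled ((l , d) ∷ m′) = trans (+-cong (*-assoc k l _) (scaled m′)) (sym (distribˡ k _ _))

  pairing-+ : ∀ (m : Free B) f g → ⟪ m , (λ b → f b + g b) ⟫ ≈ ⟪ m , f ⟫ + ⟪ m , g ⟫
  pairing-+ []            f g = sym (+-identityʳ 0#)
  pairing-+ ((k , b) ∷ m) f g =
    trans (+-cong (distribˡ k _ _) (pairing-+ m f g)) (interchange _ _ _ _)

  pairing-* : ∀ l (m : Free B) f → ⟪ m , (λ b → l * f b) ⟫ ≈ l * ⟪ m , f ⟫
  pairing-* l []            f = sym (zeroʳ l)
  pairing-* l ((k , b) ∷ m) f = trans (+-cong (x∙yz≈y∙xz k l _) (pairing-* l m f)) (sym (distribˡ l _ _))

  pairing-0 : ∀ (m : Free B) → ⟪ m , (λ _ → 0#) ⟫ ≈ 0#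
  pairing-0 []            = ≈-refl
  pairing-0 ((k , b) ∷ m) = trans (+-cong (zeroʳ k) (pairing-0 m)) (+-identityʳ 0#)

  pairing-swap : ∀ (m : Free B) (m′ : Free D) (f : B → D → Carrier) →
    ⟪ m , (λ b → ⟪ m′ , f b ⟫) ⟫ ≈ ⟪ m′ , (λ d → ⟪ m , (λ b → f b d) ⟫) ⟫
  pairing-swap []            m′ f = sym (pairing-0 m′)
  pairing-swap ((k , b) ∷ m) m′ f = begin
    k * ⟪ m′ , f b ⟫ + ⟪ m , (λ b → ⟪ m′ , f b ⟫) ⟫
      ≈⟨ +-cong (sym (pairing-* k m′ (f b))) (pairing-swap m m′ f) ⟩
    ⟪ m′ , (λ d → k * f b d) ⟫ + ⟪ m′ , (λ d → ⟪ m , (λ b → f b d) ⟫) ⟫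
      ≈⟨ pairing-+ m′ (λ d → k * f b d) (λ d → ⟪ m , (λ b → f b d) ⟫) ⟨
    ⟪ m′ , (λ d → k * f b d + ⟪ m , (λ b → f b d) ⟫) ⟫ ∎

  pairing-x⊗ : ∀ (b : B) (m : Free D) f → ⟪ basis b ⊗ m , f ⟫ ≈ ⟪ m , (λ d → f (b , d)) ⟫
  pairing-x⊗ b m f = trans (pairing-⊗ (basis b) m f) (pairing-basis b (λ b → ⟪ m , (λ d → f (b , d)) ⟫))

  ⊕-cong : {m m′ w w′ : Free B} → m ≃ m′ → w ≃ w′ → m ⊕ w ≃ m′ ⊕ w′
  ⊕-cong {m = m} {m′} p q = mk≃ λ f →
    trans (pairing-⊕ m _ f) (trans (+-cong (at p f) (at q f)) (sym (pairing-⊕ m′ _ f)))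

  •-cong : ∀ k {m m′ : Free B} → m ≃ m′ → k • m ≃ k • m′
  •-cong k {m} {m′} p = mk≃ λ f → trans (pairing-• k m f) (trans (*-congˡ (at p f)) (sym (pairing-• k m′ f)))

  -- F is the linear extension of its values on the basis. This single equation yields additivity
  -- and homogeneity, as in `Linear-combine`.
  Linear : (Free B → Free D) → Set _
  Linear F = ∀ m f → ⟪ F m , f ⟫ ≈ ⟪ m , (λ b → ⟪ F (basis b) , f ⟫) ⟫

  linear-isLinear : (g : B → Free D) → Linear (linear g)
  linear-isLinear g m f = trans (pairing-linear g m f) (pairing-cong m λ b →
    sym (trans (pairing-linear g (basis b) f) (pairing-basis b (λ b → ⟪ g b , f ⟫))))

  Linear-combine : {F : Free B → Free D} → Linear F → ∀ k m m′ → F (k • m ⊕ m′) ≃ k • F m ⊕ F m′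
  Linear-combine {F = F} lin k m m′ = mk≃ λ f → begin
    ⟪ F (k • m ⊕ m′) , f ⟫                            ≈⟨ lin (k • m ⊕ m′) f ⟩
    ⟪ k • m ⊕ m′ , (λ b → ⟪ F (basis b) , f ⟫) ⟫      ≈⟨ trans (pairing-⊕ (k • m) m′ _) (+-congʳ (pairing-• k m _)) ⟩
    k * ⟪ m , _ ⟫ + ⟪ m′ , (λ b → ⟪ F (basis b) , f ⟫) ⟫
                                                      ≈⟨ +-cong (*-congˡ (lin m f)) (lin m′ f) ⟨
    k * ⟪ F m , f ⟫ + ⟪ F m′ , f ⟫                    ≈⟨ trans (pairing-⊕ (k • F m) (F m′) f) (+-congʳ (pairing-• k (F m) f)) ⟨
    ⟪ k • F m ⊕ F m′ , f ⟫                            ∎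

  Linear-cong : {F : Free B → Free D} → Linear F → ∀ {m m′} → m ≃ m′ → F m ≃ F m′
  Linear-cong lin {m} {m′} p = mk≃ λ f → trans (lin m f) (trans (at p _) (sym (lin m′ f)))

  module _ {b ℓb} (S : DecSetoid b ℓb) where
    open DecSetoid S using (_≟_)
    open Equality S

    coeff-pairing : ∀ b m → coeff b m ≈ ⟪ m , (λ b′ → if does (b ≟ b′) then 1# else 0#) ⟫
    coeff-pairing b []             = ≈-refl
    coeff-pairing b ((k , b′) ∷ m) with does (b ≟ b′)
    ... | true  = +-cong (sym (*-identityʳ k)) (coeff-pairing b m)
    ... | false = +-cong (sym (zeroʳ k)) (coeff-pairing b m)

    ≃⇒≋ : ∀ {m m′} → m ≃ m′ → m ≋ m′
    ≃⇒≋ {m} {m′} p b = trans (coeff-pairing b m) (trans (at p _) (sym (coeff-pairing b m′)))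

module _ {a ℓa ℓa# c ℓ ℓ#} {C : HeytingField a ℓa ℓa#}
    (K : RationalFunctionField C c ℓ ℓ#) {n : ℕ} (μ : Partition (suc n)) where
  open RationalFunctionField K
    using (commutativeRing; ring; Carrier; _≈_; _+_; _*_; _-_; -_; 0#; 1#; _^_; q; s; setoid; sym; trans;
           reflexive; +-cong; +-congˡ; +-congʳ; *-cong; *-congˡ; *-congʳ; +-identityʳ; *-identityˡ; *-identityʳ;
           zeroˡ; +-assoc; +-comm; distribˡ; -‿inverseˡ)
    renaming (refl to ≈-refl)
  open Coefficients K using (s⁻¹)
  open Modules K μ
  open HeckeAlgebra commutativeRing s n using () renaming (_+_ to _+ᴴ_; _*_ to _*ᴴ_)
  open Functionals commutativeRing
  open RingProperties ring using (-1*x≈-x)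
  open CommutativeSemigroupProperties (CommutativeRing.+-commutativeSemigroup commutativeRing) using (x∙yz≈y∙xz)
  open import Relation.Binary.Reasoning.Setoid setoid

  HeckeWord : Set c
  HeckeWord = Setoid.Carrier Hecke

  -- Exponents produced by T_i and its inverse.

  HasMoves : (ℕ → ℕ → Set) → Fin n → Exponents → Poly → Set c
  HasMoves R i u = All λ (_ , u′) → ∃₂ λ a b →
    Move R (lookup u (inject₁ i)) (lookup u (suc i)) a b × u′ ≡ setAdjacent i u a b

  X·∂ : ∀ i u → Poly
  X·∂ i u = X (suc i) · ∂ i u

  module _ (i : Fin n) (u : Exponents) where
    private
      x y : ℕ
      x = lookup u (inject₁ i)
      y = lookup u (suc i)

    X·∂-descending : ∀ {R} → y ≤ x → HasMoves R i u (X·∂ i u)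
    X·∂-descending {R} y≤x rewrite ℕ.m≤n⇒m∸n≡0 y≤x =
      All.++⁺ (All.map⁺ (All.++⁺ (All.applyUpTo⁺₁ _ (x ∸ y)
        (λ {k} k< → _ , _ , descending-move k y≤x k< , x^-setAdjacent i u _ _)) [])) []

    -- For x < y only the second half of `∂` is nonempty. Its term 0 times x_{i+1} is x^u with
    -- coefficient -1, and p collects the remaining terms.
    X·∂-ascending : ∀ {R} → x < y → ∃ λ p → HasMoves R i u p × X·∂ i u ≃ (- 1#) • x^ u ⊕ p
    X·∂-ascending {R} x<y = go (y ∸ x) refl
      where
      f : ℕ → Carrier × Exponents
      f k = - 1# , setAdjacent i u (x ℕ.+ k) (y ∸ suc k)
      mul : Carrier × Exponents → Carrier × Exponents
      mul (l , u) = 1# * l , zipWith ℕ._+_ (replicate (suc n) 0 [ suc i ]≔ 1) u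
      head : zipWith ℕ._+_ (replicate (suc n) 0 [ suc i ]≔ 1) (setAdjacent i u (x ℕ.+ 0) (y ∸ 1)) ≡ u
      head = ≡.trans (x^-setAdjacent i u _ _) (≡.trans
        (≡.cong₂ (setAdjacent i u) (ℕ.+-identityʳ x) (≡.sym (ℕ.+-∸-assoc 1 (ℕ.≤-trans (s≤s z≤n) x<y))))
        (setAdjacent-restore i u))
      -- The length is generalised to d so that matching on it exposes the first term of
      -- `applyUpTo`.
      go : ∀ d → y ∸ x ≡ d → ∃ λ p → HasMoves R i u p × X·∂ i u ≃ (- 1#) • x^ u ⊕ p
      go zero    eq = contradiction eq (ℕ.m>n⇒m∸n≢0 x<y)
      go (suc d) eq rewrite ℕ.m≤n⇒m∸n≡0 (ℕ.<⇒≤ x<y) | eq =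
        map mul (applyUpTo (f ∘ suc) d) ++ [] ,
        All.++⁺ (All.map⁺ (All.applyUpTo⁺₁ _ d
          (λ {k} k< → _ , _ , ascending-move k (ℕ.<⇒≤ x<y) (≡.subst (suc k <_) (≡.sym eq) (s≤s k<)) ,
             x^-setAdjacent i u _ _))) [] ,
        mk≃ λ g → +-congʳ (*-cong (trans (*-identityˡ _) (sym (*-identityʳ _))) (reflexive (≡.cong g head)))

    𝐓-exponents : ∃ λ p → HasMoves _<_ i u p × X·∂ i u ≃ p
    𝐓-exponents with x ℕ.<? y
    ... | no  x≮y = X·∂ i u , X·∂-descending (ℕ.≮⇒≥ x≮y) , mk≃ λ _ → ≈-refl
    ... | yes x<y with X·∂-ascending x<y
    ...   | p , moves , X·∂≃ =
      (- 1#) • x^ u ⊕ p , (x , y , kept x<y , ≡.sym (setAdjacent-restore i u)) ∷ moves , X·∂≃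

    -- The added x^u is the scalar part of `𝐓⁻¹`, which has the same factor 1 - s as the divided
    -- difference. For x < y it removes the only kept term; for x ≥ y it is itself the kept term.
    𝐓⁻¹-exponents : ∃ λ p → HasMoves _≥_ i u p × X·∂ i u ⊕ x^ u ≃ p
    𝐓⁻¹-exponents with x ℕ.<? y
    ... | no  x≮y = X·∂ i u ⊕ x^ u ,
      All.++⁺ (X·∂-descending (ℕ.≮⇒≥ x≮y)) ((x , y , kept (ℕ.≮⇒≥ x≮y) , ≡.sym (setAdjacent-restore i u)) ∷ []) ,
      mk≃ λ _ → ≈-refl
    ... | yes x<y with X·∂-ascending x<y
    ...   | p , moves , X·∂≃ = p , moves , mk≃ λ f → begin
      ⟪ X·∂ i u ⊕ x^ u , f ⟫                    ≈⟨ trans (pairing-⊕ (X·∂ i u) (x^ u) f) (+-congʳ (at X·∂≃ f)) ⟩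
      ((- 1# * 1#) * f u + ⟪ p , f ⟫) + ⟪ x^ u , f ⟫
        ≈⟨ +-cong (trans (+-congʳ (trans (*-congʳ (*-identityʳ _)) (-1*x≈-x (f u)))) (+-comm _ _)) (pairing-basis u f) ⟩
      (⟪ p , f ⟫ + - f u) + f u                 ≈⟨ trans (+-assoc _ _ _) (+-congˡ (-‿inverseˡ (f u))) ⟩
      ⟪ p , f ⟫ + 0#                            ≈⟨ +-identityʳ _ ⟩
      ⟪ p , f ⟫                                 ∎

  -- The operators on tensors of a monomial with a vector.

  ⊗-congˡ : ∀ {p p′ : Poly} (w : V) → p ≃ p′ → p ⊗ w ≃ p′ ⊗ w
  ⊗-congˡ {p} {p′} w p≃p′ = mk≃ λ f → trans (pairing-⊗ p w f) (trans (at p≃p′ _) (sym (pairing-⊗ p′ w f)))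

  𝐓-linear : ∀ i → Linear (λ m → 𝐓 m i)
  𝐓-linear i = linear-isLinear _

  𝐓⁻¹-pairing : ∀ i m f → ⟪ 𝐓⁻¹ m i , f ⟫ ≈ s⁻¹ * (⟪ 𝐓 m i , f ⟫ + (1# - s) * ⟪ m , f ⟫)
  𝐓⁻¹-pairing i m f = trans (pairing-• s⁻¹ (𝐓 m i ⊕ (1# - s) • m) f)
    (*-congˡ (trans (pairing-⊕ (𝐓 m i) _ f) (+-congˡ (pairing-• (1# - s) m f))))

  𝐓⁻¹-linear : ∀ i → Linear (λ m → 𝐓⁻¹ m i)
  𝐓⁻¹-linear i m f = begin
    ⟪ 𝐓⁻¹ m i , f ⟫
      ≈⟨ 𝐓⁻¹-pairing i m f ⟩
    s⁻¹ * (⟪ 𝐓 m i , f ⟫ + (1# - s) * ⟪ m , f ⟫)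
      ≈⟨ *-congˡ (+-cong (𝐓-linear i m f) (sym (pairing-* (1# - s) m f))) ⟩
    s⁻¹ * (⟪ m , (λ b → ⟪ 𝐓 (basis b) i , f ⟫) ⟫ + ⟪ m , (λ b → (1# - s) * f b) ⟫)
      ≈⟨ *-congˡ (pairing-+ m (λ b → ⟪ 𝐓 (basis b) i , f ⟫) (λ b → (1# - s) * f b)) ⟨
    s⁻¹ * ⟪ m , (λ b → ⟪ 𝐓 (basis b) i , f ⟫ + (1# - s) * f b) ⟫
      ≈⟨ pairing-* s⁻¹ m (λ b → ⟪ 𝐓 (basis b) i , f ⟫ + (1# - s) * f b) ⟨
    ⟪ m , (λ b → s⁻¹ * (⟪ 𝐓 (basis b) i , f ⟫ + (1# - s) * f b)) ⟫
      ≈⟨ pairing-cong m (λ b → trans (𝐓⁻¹-pairing i (basis b) f) (*-congˡ (+-congˡ (*-congˡ (pairing-basis b f))))) ⟨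
    ⟪ m , (λ b → ⟪ 𝐓⁻¹ (basis b) i , f ⟫) ⟫ ∎

  𝐰-linear : Linear 𝐰
  𝐰-linear = linear-isLinear _

  pairing-linear-x⊗ : ∀ {d} {D : Set d} (g : Exponents × Tab μ → Free D) u (w : V) f →
    ⟪ linear g (x^ u ⊗ w) , f ⟫ ≈ ⟪ w , (λ 𝕊 → ⟪ g (u , 𝕊) , f ⟫) ⟫
  pairing-linear-x⊗ g u w f = trans (pairing-linear g (x^ u ⊗ w) f) (pairing-x⊗ u w (λ b → ⟪ g b , f ⟫))

  -- `𝐓` is defined on basis tableaux; expanding w and interchanging the finite sums extends the
  -- formula to any vector, in particular to 𝕋h.
  𝐓-x⊗ : ∀ u (w : V) i → 𝐓 (x^ u ⊗ w) i ≃ ((1# - s) • X·∂ i u) ⊗ w ⊕ x^ swap i u ⊗ (w ◃ T i)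
  𝐓-x⊗ u w i = mk≃ λ f → begin
    ⟪ 𝐓 (x^ u ⊗ w) i , f ⟫
      ≈⟨ pairing-linear-x⊗ _ u w f ⟩
    ⟪ w , (λ 𝕊 → ⟪ p ⊗ basis 𝕊 ⊕ x^ swap i u ⊗ 𝕊 T⟨ i ⟩ , f ⟫) ⟫
      ≈⟨ pairing-cong w (λ 𝕊 → trans (pairing-⊕ (p ⊗ basis 𝕊) _ f)
           (+-cong (trans (pairing-⊗ p (basis 𝕊) f) (pairing-cong p λ u′ → pairing-basis 𝕊 (λ 𝕊 → f (u′ , 𝕊))))
                   (pairing-x⊗ (swap i u) (𝕊 T⟨ i ⟩) f))) ⟩
    ⟪ w , (λ 𝕊 → ⟪ p , (λ u′ → f (u′ , 𝕊)) ⟫ + ⟪ 𝕊 T⟨ i ⟩ , (λ 𝕊′ → f (swap i u , 𝕊′)) ⟫) ⟫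
      ≈⟨ pairing-+ w (λ 𝕊 → ⟪ p , (λ u′ → f (u′ , 𝕊)) ⟫) (λ 𝕊 → ⟪ 𝕊 T⟨ i ⟩ , (λ 𝕊′ → f (swap i u , 𝕊′)) ⟫) ⟩
    ⟪ w , (λ 𝕊 → ⟪ p , (λ u′ → f (u′ , 𝕊)) ⟫) ⟫ + ⟪ w , (λ 𝕊 → ⟪ 𝕊 T⟨ i ⟩ , (λ 𝕊′ → f (swap i u , 𝕊′)) ⟫) ⟫
      ≈⟨ +-cong (trans (pairing-⊗ p w f) (pairing-swap p w (λ u′ 𝕊 → f (u′ , 𝕊))))
                (trans (pairing-x⊗ (swap i u) (w ◃ T i) f) (pairing-linear _T⟨ i ⟩ w _)) ⟨
    ⟪ p ⊗ w , f ⟫ + ⟪ x^ swap i u ⊗ (w ◃ T i) , f ⟫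
      ≈⟨ pairing-⊕ (p ⊗ w) _ f ⟨
    ⟪ p ⊗ w ⊕ x^ swap i u ⊗ (w ◃ T i) , f ⟫ ∎
    where
    p : Poly
    p = (1# - s) • X·∂ i u

  -- The scalar part is merged with the divided difference in the polynomial factor, where
  -- `𝐓⁻¹-exponents` applies.
  𝐓⁻¹-x⊗ : ∀ u (w : V) i →
    𝐓⁻¹ (x^ u ⊗ w) i ≃ s⁻¹ • (((1# - s) • (X·∂ i u ⊕ x^ u)) ⊗ w ⊕ x^ swap i u ⊗ (w ◃ T i))
  𝐓⁻¹-x⊗ u w i = •-cong s⁻¹ (mk≃ λ f → begin
    ⟪ 𝐓 (x^ u ⊗ w) i ⊕ κ • (x^ u ⊗ w) , f ⟫
      ≈⟨ trans (pairing-⊕ (𝐓 (x^ u ⊗ w) i) _ f)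
           (+-cong (trans (at (𝐓-x⊗ u w i) f) (pairing-⊕ ((κ • X·∂ i u) ⊗ w) _ f))
                   (trans (pairing-• κ (x^ u ⊗ w) f) (*-congˡ (pairing-⊗ (x^ u) w f)))) ⟩
    (⟪ (κ • X·∂ i u) ⊗ w , f ⟫ + S f) + κ * ⟪ x^ u , F f ⟫
      ≈⟨ +-congʳ (+-congʳ (trans (pairing-⊗ (κ • X·∂ i u) w f) (pairing-• κ (X·∂ i u) _))) ⟩
    (κ * ⟪ X·∂ i u , F f ⟫ + S f) + κ * ⟪ x^ u , F f ⟫
      ≈⟨ trans (+-assoc _ _ _) (trans (+-congˡ (+-comm _ _)) (sym (+-assoc _ _ _))) ⟩
    (κ * ⟪ X·∂ i u , F f ⟫ + κ * ⟪ x^ u , F f ⟫) + S f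
      ≈⟨ +-congʳ (trans (*-congˡ (pairing-⊕ (X·∂ i u) (x^ u) (F f))) (distribˡ κ _ _)) ⟨
    κ * ⟪ X·∂ i u ⊕ x^ u , F f ⟫ + S f
      ≈⟨ +-congʳ (trans (pairing-⊗ (κ • (X·∂ i u ⊕ x^ u)) w f) (pairing-• κ (X·∂ i u ⊕ x^ u) (F f))) ⟨
    ⟪ (κ • (X·∂ i u ⊕ x^ u)) ⊗ w , f ⟫ + S f
      ≈⟨ pairing-⊕ ((κ • (X·∂ i u ⊕ x^ u)) ⊗ w) _ f ⟨
    ⟪ (κ • (X·∂ i u ⊕ x^ u)) ⊗ w ⊕ x^ swap i u ⊗ (w ◃ T i) , f ⟫ ∎)
    where
    κ : Carrier
    κ = 1# - s
    F : (Exponents × Tab μ → Carrier) → Exponents → Carrier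
    F f u = ⟪ w , (λ 𝕊 → f (u , 𝕊)) ⟫
    S : (Exponents × Tab μ → Carrier) → Carrier
    S f = ⟪ x^ swap i u ⊗ (w ◃ T i) , f ⟫

  foldl-◃-linear : ∀ (l : List (Fin n)) → Linear (λ w → foldl (λ u i → u ◃ T i) w l)
  foldl-◃-linear []      w f = pairing-cong w λ 𝕊 → sym (pairing-basis 𝕊 f)
  foldl-◃-linear (i ∷ l) w f = begin
    ⟪ foldl _ (w ◃ T i) l , f ⟫
      ≈⟨ foldl-◃-linear l (w ◃ T i) f ⟩
    ⟪ w ◃ T i , g ⟫
      ≈⟨ linear-isLinear (_T⟨ i ⟩) w g ⟩
    ⟪ w , (λ 𝕊 → ⟪ basis 𝕊 ◃ T i , g ⟫) ⟫
      ≈⟨ pairing-cong w (λ 𝕊 → foldl-◃-linear l (basis 𝕊 ◃ T i) f) ⟨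
    ⟪ w , (λ 𝕊 → ⟪ foldl _ (basis 𝕊 ◃ T i) l , f ⟫) ⟫ ∎
    where
    g : Tab μ → Carrier
    g 𝕊 = ⟪ foldl (λ u i → u ◃ T i) (basis 𝕊) l , f ⟫

  𝐰-x⊗ : ∀ u₁ u (w : V) →
    𝐰 (x^ (u₁ ∷ u) ⊗ w) ≃ ((q ^ u₁) • (x^ (u ∷ʳ u₁))) ⊗ foldl (λ u i → u ◃ T i) w (allFin n)
  𝐰-x⊗ u₁ u w = mk≃ λ f → begin
    ⟪ 𝐰 (x^ (u₁ ∷ u) ⊗ w) , f ⟫
      ≈⟨ pairing-linear-x⊗ _ (u₁ ∷ u) w f ⟩
    ⟪ w , (λ 𝕊 → ⟪ p ⊗ W (basis 𝕊) , f ⟫) ⟫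
      ≈⟨ pairing-cong w (λ 𝕊 → pairing-⊗ p (W (basis 𝕊)) f) ⟩
    ⟪ w , (λ 𝕊 → ⟪ p , (λ u → ⟪ W (basis 𝕊) , (λ 𝕊′ → f (u , 𝕊′)) ⟫) ⟫) ⟫
      ≈⟨ pairing-swap w p (λ 𝕊 u → ⟪ W (basis 𝕊) , (λ 𝕊′ → f (u , 𝕊′)) ⟫) ⟩
    ⟪ p , (λ u → ⟪ w , (λ 𝕊 → ⟪ W (basis 𝕊) , (λ 𝕊′ → f (u , 𝕊′)) ⟫) ⟫) ⟫
      ≈⟨ pairing-cong p (λ u → foldl-◃-linear (allFin n) w (λ 𝕊 → f (u , 𝕊))) ⟨
    ⟪ p , (λ u → ⟪ W w , (λ 𝕊 → f (u , 𝕊)) ⟫) ⟫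
      ≈⟨ pairing-⊗ p (W w) f ⟨
    ⟪ p ⊗ W w , f ⟫ ∎
    where
    p : Poly
    p = (q ^ u₁) • (x^ (u ∷ʳ u₁))
    W : V → V
    W w = foldl (λ u i → u ◃ T i) w (allFin n)

  -- Acting by h and then by T_i is by definition acting by the product word.
  foldl-◃-word : ∀ (w : V) h l → foldl (λ u i → u ◃ T i) (w ◃ h) l ≡ w ◃ foldl (λ g i → g *ᴴ T i) h l
  foldl-◃-word w h []      = refl
  foldl-◃-word w h (i ∷ l) = foldl-◃-word w (h *ᴴ T i) l

  -- Expansions in terms x^u ⊗ 𝕋h.

  module _ (𝕋 : Tab μ) where

    term : Exponents × HeckeWord → M
    term (u , h) = x^ u ⊗ (basis 𝕋 ◃ h)

    -- The Hecke words are kept formal, so that the elements H can be read off at the end. Exponents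
    -- may repeat until `collect` merges them.
    record Spanned (P : Exponents → Set) (m : M) : Set (c Level.⊔ ℓ) where
      constructor spanned
      field
        {terms}  : Free (Exponents × HeckeWord)
        exponents : All (λ (_ , u , _) → P u) terms
        expansion : m ≃ linear term terms

    module _ {P : Exponents → Set} where

      Spanned-≃ : ∀ {m m′} → m ≃ m′ → Spanned P m′ → Spanned P m
      Spanned-≃ p (spanned ps q) = spanned ps (≃-trans p q)

      Spanned-⊕ : ∀ {m m′} → Spanned P m → Spanned P m′ → Spanned P (m ⊕ m′)
      Spanned-⊕ (spanned {E} ps p) (spanned {E′} ps′ p′) = spanned (All.++⁺ ps ps′)
        (≃-trans (⊕-cong p p′) (mk≃ λ f → reflexive (≡.cong ⟪_, f ⟫ (≡.sym (List.concatMap-++ _ E E′)))))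

      Spanned-• : ∀ {m} k → Spanned P m → Spanned P (k • m)
      Spanned-• k (spanned {E} ps p) = spanned (All.map⁺ ps) (≃-trans (•-cong k p) (mk≃ λ f → begin
        ⟪ k • linear term E , f ⟫                 ≈⟨ pairing-• k (linear term E) f ⟩
        k * ⟪ linear term E , f ⟫                 ≈⟨ *-congˡ (pairing-linear term E f) ⟩
        k * ⟪ E , (λ b → ⟪ term b , f ⟫) ⟫        ≈⟨ pairing-• k E _ ⟨
        ⟪ k • E , (λ b → ⟪ term b , f ⟫) ⟫        ≈⟨ pairing-linear term (k • E) f ⟨
        ⟪ linear term (k • E) , f ⟫               ∎))

      Spanned-⊗ : ∀ {p} h → All (λ (_ , u) → P u) p → Spanned P (p ⊗ (basis 𝕋 ◃ h))
      Spanned-⊗ {p} h ps = spanned (All.map⁺ ps) (mk≃ λ f → begin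
        ⟪ p ⊗ (basis 𝕋 ◃ h) , f ⟫                              ≈⟨ pairing-⊗ p (basis 𝕋 ◃ h) f ⟩
        ⟪ p , (λ u → ⟪ basis 𝕋 ◃ h , (λ 𝕊 → f (u , 𝕊)) ⟫) ⟫    ≈⟨ pairing-cong p (λ u → pairing-x⊗ u (basis 𝕋 ◃ h) f) ⟨
        ⟪ p , (λ u → ⟪ term (u , h) , f ⟫) ⟫                   ≈⟨ pairing-label p (λ b → ⟪ term b , f ⟫) ⟨
        ⟪ map label p , (λ b → ⟪ term b , f ⟫) ⟫               ≈⟨ pairing-linear term (map label p) f ⟨
        ⟪ linear term (map label p) , f ⟫                      ∎)
        where
        label : Carrier × Exponents → Carrier × Exponents × HeckeWord
        label (k , u) = k , u , h
        pairing-label : ∀ p g → ⟪ map label p , g ⟫ ≈ ⟪ p , (λ u → g (u , h)) ⟫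
        pairing-label []      g = ≈-refl
        pairing-label (_ ∷ p) g = +-congˡ (pairing-label p g)

      Spanned-basis : ∀ {u} h → P u → Spanned P (x^ u ⊗ (basis 𝕋 ◃ h))
      Spanned-basis h p = Spanned-⊗ h (p ∷ [])

    Spanned-map : ∀ {P Q : Exponents → Set} {F : M → M} → Linear F →
      (∀ u h → P u → Spanned Q (F (x^ u ⊗ (basis 𝕋 ◃ h)))) → ∀ {m} → Spanned P m → Spanned Q (F m)
    Spanned-map {P} {Q} {F} lin step (spanned {E} ps p) = Spanned-≃ (Linear-cong {F = F} lin p) (go E ps)
      where
      go : ∀ E → All (λ (_ , u , _) → P u) E → Spanned Q (F (linear term E))
      go []                []       = spanned [] (mk≃ λ f → lin [] f)
      go ((k , u , h) ∷ E) (p ∷ ps) = Spanned-≃ (Linear-combine {F = F} lin k (term (u , h)) (linear term E))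
        (Spanned-⊕ (Spanned-• k (step u h p)) (go E ps))

    -- The factors of Ξ_j applied to expansions.

    module _ (v : Exponents) (j : Fin (suc n)) where

      HasMoves⇒Reachable : ∀ {R i u p} → (∀ {x y} → R x y → Shift j i x y) → Reachable v j (suc i) u →
        HasMoves R i u p → All (λ (_ , u′) → Reachable v j (inject₁ i) u′) p
      HasMoves⇒Reachable R⇒ ρ = All.map λ { (_ , _ , move , refl) → Reachable-step v j R⇒ ρ move }

      swap-Reachable : ∀ {i u} → Reachable v j (suc i) u → Reachable v j (inject₁ i) (swap i u)
      -- Only the exchange occurs, so the empty relation is taken for kept pairs and its condition
      -- holds vacuously.
      swap-Reachable {i} ρ = Reachable-step v j {R = λ _ _ → ⊥} (λ ()) ρ swapped

      -- Here i ≥ j, where the other entries may only increase; a pair kept by T_i has x < y, which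
      -- is such an increase.
      𝐓-Spanned : ∀ {i m} → toℕ j ≤ toℕ i → Spanned (Reachable v j (suc i)) m → Spanned (Reachable v j (inject₁ i)) (𝐓 m i)
      𝐓-Spanned {i} j≤i = Spanned-map (𝐓-linear i) λ u h ρ →
        let p , moves , X·∂≃ = 𝐓-exponents i u in
        Spanned-≃ (≃-trans (𝐓-x⊗ u (basis 𝕋 ◃ h) i)
            (⊕-cong (⊗-congˡ (basis 𝕋 ◃ h) (•-cong (1# - s) X·∂≃)) (mk≃ λ _ → ≈-refl)))
          (Spanned-⊕ (Spanned-⊗ h (All.map⁺ (HasMoves⇒Reachable
              (λ x<y → (λ i<j → contradiction i<j (ℕ.≤⇒≯ j≤i)) , λ _ → ℕ.<⇒≤ x<y) ρ moves)))
            (Spanned-basis (h *ᴴ T i) (swap-Reachable ρ)))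

      -- Here i < j, where the other entries may only decrease; a pair kept by the inverse has x ≥
      -- y.
      𝐓⁻¹-Spanned : ∀ {i m} → toℕ i < toℕ j → Spanned (Reachable v j (suc i)) m → Spanned (Reachable v j (inject₁ i)) (𝐓⁻¹ m i)
      𝐓⁻¹-Spanned {i} i<j = Spanned-map (𝐓⁻¹-linear i) λ u h ρ →
        let p , moves , X·∂≃ = 𝐓⁻¹-exponents i u in
        Spanned-≃ (≃-trans (𝐓⁻¹-x⊗ u (basis 𝕋 ◃ h) i)
            (•-cong s⁻¹ (⊕-cong (⊗-congˡ (basis 𝕋 ◃ h) (•-cong (1# - s) X·∂≃)) (mk≃ λ _ → ≈-refl))))
          (Spanned-• s⁻¹ (Spanned-⊕ (Spanned-⊗ h (All.map⁺ (HasMoves⇒Reachable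
              (λ x≥y → (λ _ → x≥y) , λ j≤i → contradiction i<j (ℕ.≤⇒≯ j≤i)) ρ moves)))
            (Spanned-basis (h *ᴴ T i) (swap-Reachable ρ))))

      𝐰-Spanned : ∀ {m} → Spanned (Reachable v j zero) m → Spanned (Reachable v j (fromℕ n)) (𝐰 m)
      𝐰-Spanned = Spanned-map 𝐰-linear λ { (u₁ ∷ u) h ρ →
        Spanned-≃ (𝐰-x⊗ u₁ u (basis 𝕋 ◃ h))
          (≡.subst (λ w → Spanned (Reachable v j (fromℕ n)) (((q ^ u₁) • (x^ (u ∷ʳ u₁))) ⊗ w))
            (≡.sym (foldl-◃-word (basis 𝕋) h (allFin n)))
            (Spanned-⊗ (foldl (λ g i → g *ᴴ T i) h (allFin n)) (Reachable-rotate v j ρ ∷ []))) }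

      foldl-Spanned : ∀ {I : Fin n → Set} {F : M → Fin n → M} →
        (∀ {i m} → I i → Spanned (Reachable v j (suc i)) m → Spanned (Reachable v j (inject₁ i)) (F m i)) →
        ∀ {k l k′ m} → Descends k l k′ → All I l → Spanned (Reachable v j k) m → Spanned (Reachable v j k′) (foldl F m l)
      foldl-Spanned step []      []       σ = σ
      foldl-Spanned step (i ∷ d) (p ∷ ps) σ = foldl-Spanned step d ps (step p σ)

      Ξ-Spanned : Spanned (_⊴ v) (Ξ (x^ v ⊗ basis 𝕋) j)
      Ξ-Spanned = Spanned-weaken (Reachable-end v j) (Spanned-• _
        (foldl-Spanned 𝐓-Spanned (Descends-above n j) (All.all-filter _ (reverse (allFin n)))
          (𝐰-Spanned
            (foldl-Spanned 𝐓⁻¹-Spanned (Descends-below n j) (All.all-filter _ (reverse (allFin n)))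
              -- The initial Hecke word is the scalar 1, which replaces 𝕋 by 𝕋 acted on by a word.
              (Spanned-≃ initial (Spanned-basis (scalar 1#) (Reachable-start v j)))))))
        where
        Spanned-weaken : ∀ {P Q : Exponents → Set} {m} → (∀ {u} → P u → Q u) → Spanned P m → Spanned Q m
        Spanned-weaken P⇒Q (spanned ps p) = spanned (All.map P⇒Q ps) p
        initial : x^ v ⊗ basis 𝕋 ≃ x^ v ⊗ (basis 𝕋 ◃ scalar 1#)
        initial = mk≃ λ f → +-congʳ (*-congʳ (*-congˡ (sym (*-identityˡ 1#))))

    -- Collecting terms with equal exponents.

    _≟_ : (u u′ : Exponents) → Dec (u ≡ u′)
    _≟_ = Vec.≡-dec ℕ._≟_

    -- The coefficient stands to the right of h, so that acting by the product unfolds to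
    -- `k • (basis 𝕋 ◃ h)`.
    collect : Free (Exponents × HeckeWord) → Exponents → HeckeWord
    collect []                u′ = scalar 0#
    collect ((k , u , h) ∷ E) u′ = if does (u ≟ u′) then (h *ᴴ scalar k) +ᴴ collect E u′ else collect E u′

    collected : Free (Exponents × HeckeWord) → Exponents → M
    collected E u = x^ u ⊗ (basis 𝕋 ◃ collect E u)

    collected-≡ : ∀ k u h E f →
      ⟪ collected ((k , u , h) ∷ E) u , f ⟫ ≈ k * ⟪ term (u , h) , f ⟫ + ⟪ collected E u , f ⟫
    collected-≡ k u h E f with u ≟ u
    ... | no  u≢u = contradiction refl u≢u
    ... | yes _   = begin
      ⟪ x^ u ⊗ (k • (basis 𝕋 ◃ h) ⊕ basis 𝕋 ◃ collect E u) , f ⟫ ≈⟨ pairing-x⊗ u (k • (basis 𝕋 ◃ h) ⊕ basis 𝕋 ◃ collect E u) f ⟩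
      ⟪ k • (basis 𝕋 ◃ h) ⊕ basis 𝕋 ◃ collect E u , g ⟫          ≈⟨ pairing-⊕ (k • (basis 𝕋 ◃ h)) (basis 𝕋 ◃ collect E u) g ⟩
      ⟪ k • (basis 𝕋 ◃ h) , g ⟫ + ⟪ basis 𝕋 ◃ collect E u , g ⟫  ≈⟨ +-congʳ (pairing-• k (basis 𝕋 ◃ h) g) ⟩
      k * ⟪ basis 𝕋 ◃ h , g ⟫ + ⟪ basis 𝕋 ◃ collect E u , g ⟫
        ≈⟨ +-cong (*-congˡ (pairing-x⊗ u (basis 𝕋 ◃ h) f)) (pairing-x⊗ u (basis 𝕋 ◃ collect E u) f) ⟨
      k * ⟪ term (u , h) , f ⟫ + ⟪ collected E u , f ⟫           ∎
      where
      g : Tab μ → Carrier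
      g 𝕊 = f (u , 𝕊)

    collected-≢ : ∀ k {u u′} h E → u ≢ u′ → collected ((k , u , h) ∷ E) u′ ≡ collected E u′
    collected-≢ k {u} {u′} h E u≢u′ with u ≟ u′
    ... | yes u≡u′ = contradiction u≡u′ u≢u′
    ... | no  _    = refl

    ∑-collected-∉ : ∀ k {u} h E {us} → All (u ≢_) us → ∑ us (collected ((k , u , h) ∷ E)) ≡ ∑ us (collected E)
    ∑-collected-∉ k h E []          = refl
    ∑-collected-∉ k h E (u≢ ∷ u∉us) = ≡.cong₂ _⊕_ (collected-≢ k h E u≢) (∑-collected-∉ k h E u∉us)

    -- Without repetitions u occurs in us exactly once: one summand receives the new term and the
    -- others are unchanged.
    ∑-collected-∈ : ∀ k {u} h E {us} → Unique us → u ∈ us → ∀ f →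
      ⟪ ∑ us (collected ((k , u , h) ∷ E)) , f ⟫ ≈ k * ⟪ term (u , h) , f ⟫ + ⟪ ∑ us (collected E) , f ⟫
    ∑-collected-∈ k {u} h E {.u ∷ us} (u∉us ∷ _) (here refl) f
      rewrite ∑-collected-∉ k h E u∉us = begin
      ⟪ collected ((k , u , h) ∷ E) u ⊕ ∑ us (collected E) , f ⟫
        ≈⟨ pairing-⊕ (collected ((k , u , h) ∷ E) u) (∑ us (collected E)) f ⟩
      ⟪ collected ((k , u , h) ∷ E) u , f ⟫ + ⟪ ∑ us (collected E) , f ⟫
        ≈⟨ +-congʳ (collected-≡ k u h E f) ⟩
      (k * ⟪ term (u , h) , f ⟫ + ⟪ collected E u , f ⟫) + ⟪ ∑ us (collected E) , f ⟫
        ≈⟨ +-assoc _ _ _ ⟩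
      k * ⟪ term (u , h) , f ⟫ + (⟪ collected E u , f ⟫ + ⟪ ∑ us (collected E) , f ⟫)
        ≈⟨ +-congˡ (pairing-⊕ (collected E u) (∑ us (collected E)) f) ⟨
      k * ⟪ term (u , h) , f ⟫ + ⟪ collected E u ⊕ ∑ us (collected E) , f ⟫ ∎
    ∑-collected-∈ k {u} h E {u′ ∷ us} (u′∉us ∷ unique) (there u∈us) f
      rewrite collected-≢ k h E (λ u≡u′ → All.lookup u′∉us u∈us (≡.sym u≡u′)) = begin
      ⟪ collected E u′ ⊕ ∑ us (collected ((k , u , h) ∷ E)) , f ⟫
        ≈⟨ pairing-⊕ (collected E u′) (∑ us (collected ((k , u , h) ∷ E))) f ⟩
      ⟪ collected E u′ , f ⟫ + ⟪ ∑ us (collected ((k , u , h) ∷ E)) , f ⟫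
        ≈⟨ +-congˡ (∑-collected-∈ k h E unique u∈us f) ⟩
      ⟪ collected E u′ , f ⟫ + (k * ⟪ term (u , h) , f ⟫ + ⟪ ∑ us (collected E) , f ⟫)
        ≈⟨ x∙yz≈y∙xz _ _ _ ⟩
      k * ⟪ term (u , h) , f ⟫ + (⟪ collected E u′ , f ⟫ + ⟪ ∑ us (collected E) , f ⟫)
        ≈⟨ +-congˡ (pairing-⊕ (collected E u′) (∑ us (collected E)) f) ⟨
      k * ⟪ term (u , h) , f ⟫ + ⟪ collected E u′ ⊕ ∑ us (collected E) , f ⟫ ∎

    collect-correct : ∀ E {us} → Unique us → All (λ (_ , u , _) → u ∈ us) E →
      linear term E ≃ ∑ us (collected E)
    collect-correct []                {us} unique []           = mk≃ λ f → sym (empty us f)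
      where
      empty : ∀ us f → ⟪ ∑ us (collected []) , f ⟫ ≈ 0#
      empty []       f = ≈-refl
      empty (u ∷ us) f = trans (pairing-⊕ (collected [] u) (∑ us (collected [])) f)
        (trans (+-cong (trans (pairing-x⊗ u (0# • basis 𝕋) f) (trans (pairing-• 0# (basis 𝕋) (λ 𝕊 → f (u , 𝕊))) (zeroˡ _))) (empty us f))
               (+-identityʳ 0#))
    collect-correct ((k , u , h) ∷ E) {us} unique (u∈us ∷ ∈us) = mk≃ λ f → begin
      ⟪ k • term (u , h) ⊕ linear term E , f ⟫               ≈⟨ pairing-⊕ (k • term (u , h)) (linear term E) f ⟩
      ⟪ k • term (u , h) , f ⟫ + ⟪ linear term E , f ⟫       ≈⟨ +-cong (pairing-• k (term (u , h)) f) (at (collect-correct E unique ∈us) f) ⟩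
      k * ⟪ term (u , h) , f ⟫ + ⟪ ∑ us (collected E) , f ⟫  ≈⟨ ∑-collected-∈ k h E unique u∈us f ⟨
      ⟪ ∑ us (collected ((k , u , h) ∷ E)) , f ⟫             ∎

    -- The list `v ∷ below v` enumerates all u ⊴ v without repetition, and its head gives the
    -- separate summand at v.
    Spanned⇒∑ : ∀ {v m} → Spanned (_⊴ v) m → ∃ λ (H : Exponents → HeckeWord) →
      m ≃ x^ v ⊗ (basis 𝕋 ◃ H v) ⊕ ∑ (below v) (λ u → x^ u ⊗ (basis 𝕋 ◃ H u))
    Spanned⇒∑ {v} (spanned {E} ⊴v m≃) = collect E , ≃-trans m≃ (collect-correct E
      (All.tabulate (λ u∈ v≡u → proj₂ (Equivalence.to ∈-below u∈) (≡.sym v≡u)) ∷ below-unique v)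
      (All.map ∈v∷below ⊴v))
      where
      ∈v∷below : ∀ {u} → u ⊴ v → u ∈ v ∷ below v
      ∈v∷below {u} u⊴v with u ≟ v
      ... | yes refl = here refl
      ... | no  u≢v  = there (Equivalence.from ∈-below (u⊴v , u≢v))

theorem3p4 : ∀ {a ℓa ℓa# c ℓ ℓ# : Level}
    (C : HeytingField a ℓa ℓa#) (K : RationalFunctionField C c ℓ ℓ#)
    (n : ℕ) → 2 ≤ suc n → (μ : Partition (suc n)) →
    let open Modules K μ in
    (v : Exponents) (𝕋 : Tab μ) (j : Fin (suc n)) →
    ∃ λ (H : Exponents → Setoid.Carrier Hecke) →
    Ξ (x^ v ⊗ basis 𝕋) j
    ≋ x^ v ⊗ (basis 𝕋 ◃ H v) ⊕ ∑ (below v) (λ v′ → x^ v′ ⊗ (basis 𝕋 ◃ H v′))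
theorem3p4 C K n _ μ v 𝕋 j =
  let H , Ξ≃ = Spanned⇒∑ K μ 𝕋 (Ξ-Spanned K μ 𝕋 v j) in
  H , Functionals.≃⇒≋ (RationalFunctionField.commutativeRing K) _ Ξ≃
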